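{- Let $n\ge1$, $k\ge3$, $\alpha\ge 0$, and let $f:S_k^n\to[k]$ be a social choice function with $\mathbf{D}(f,\overline{\mathrm{NONMANIP}})\le\alpha$. Then either $$\mathbf{D}(f,\mathrm{NONMANIP})<100\,n^4k^8\alpha^{1/3},$$ or, for $\sigma\in S_k^n$ uniformly random, $$\mathbb{P}(\sigma\in M(f))\ge\mathbb{P}(\sigma\in M_3(f))\ge\alpha.$$
   Context: $[k]=\{1,\dots,k\}$, $S_k$ is the set of total orderings of $[k]$, and a social choice function (SCF) is a map $f:S_k^n\to[k]$; $\sigma=(\sigma_1,\dots,\sigma_n)\in S_k^n$ is a ranking profile. Write $a\overset{\sigma_i}{>}b$ if $\sigma_i$ ranks $a$ above $b$. $\sigma$ is a manipulation point of $f$ if there are $i$ and $\sigma'$ differing from $\sigma$ only in coordinate $i$ with $f(\sigma')\overset{\sigma_i}{>}f(\sigma)$; it is an $r$-manipulation point if such $\sigma'$ exists with $\sigma'_i$ obtained from $\sigma_i$ by permuting at most $r$ alternatives in adjacent positions of $\sigma_i$. $M(f)$, $M_r(f)$ denote these sets. For nonempty $H\subseteq[k]$, $\mathrm{top}_H$ maps a ranking to its highest-ranked element of $H$. A SCF taking exactly two values $a,b$ is monotone if whenever $\sigma,\sigma'$ differ only in coordinate $i$ with $f(\sigma)=a$, $f(\sigma')=b$, then $a\overset{\sigma_i}{>}b$ and $b\overset{\sigma'_i}{>}a$. $\mathrm{NONMANIP}$ is the set of SCFs which either equal $\sigma\mapsto\mathrm{top}_H(\sigma_i)$ for some $i$ and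 nonempty $H$, or are monotone and take exactly two values. $\overline{\mathrm{NONMANIP}}$ is the set of SCFs $f:S_k^n\to[k]$ that depend on only one coordinate or take at most two values. $\mathbf{D}(f,g)=\mathbb{P}(f(\sigma)\ne g(\sigma))$ for uniform $\sigma\in S_k^n$, and $\mathbf{D}(f,G)=\min_{g\in G}\mathbf{D}(f,g)$.
   Formalization: The number α is taken to be rational, and the bound D(f,NONMANIP) < 100 n^4 k^8 α^{1/3} is stated in the equivalent cubed form; since all probabilities are rational, the case of real α follows by choosing a rational slightly below α. -}

module Defs where

import Agda.Primitive

open import Data.Nat as ℕ using (ℕ; zero; suc)
open import Data.Fin using (Fin; _<_; _<?_)
import Data.Fin
open import Data.Fin.Properties using (any?; all?; _≟_)
open import Data.Fin.Subset using (Subset; _∈_; Nonempty)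
open import Data.Fin.Subset.Properties using (_∈?_)
open import Data.Bool using (Bool; true; false; T; T?; if_then_else_)
open import Data.Vec as Vec using (Vec; []; _∷_; lookup; _[_]≔_)
open import Data.List as List using (List; []; _∷_; concatMap; length; filter)
open import Data.List.Relation.Unary.Any using (Any)
open import Data.Maybe using (Maybe; just; nothing)
open import Data.Product using (Σ; ∃; _×_; _,_; proj₁)
open import Data.Sum using (_⊎_)
open import Data.Integer using (+_)
open import Data.Rational using (ℚ; _/_; 0ℚ)
open import Relation.Nullary using (Dec; yes; no; ¬_)
open import Relation.Nullary.Decidable using (⌊_⌋; _×-dec_)
open import Relation.Binary.PropositionalEquality using (_≡_; _≢_)
open import Relation.Unary using (Pred; Decidable)

-- Rankings.  A ranking of [k] (alternatives = Fin k) is a vector listing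
-- the alternatives from the top (position 0) to the bottom, in which
-- every alternative occurs (hence, having length k, each exactly once).

isPerm : ∀ {k} → Vec (Fin k) k → Bool
isPerm {k} v = ⌊ all? (λ a → any? (λ p → lookup v p ≟ a)) ⌋

Ranking : ℕ → Set
Ranking k = Σ (Vec (Fin k) k) (λ v → T (isPerm v))

Above : ∀ {k} → Vec (Fin k) k → Fin k → Fin k → Set
Above {k} v a b = ∃ λ (p : Fin k) → ∃ λ (q : Fin k) → p < q × lookup v p ≡ a × lookup v q ≡ b

above? : ∀ {k} (v : Vec (Fin k) k) (a b : Fin k) → Dec (Above v a b)
above? v a b = any? (λ p → any? (λ q → (p <? q) ×-dec ((lookup v p ≟ a) ×-dec (lookup v q ≟ b))))

_>[_]_ : ∀ {k} → Fin k → Ranking k → Fin k → Set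
a >[ r ] b = Above (proj₁ r) a b

Profile : ℕ → ℕ → Set
Profile n k = Vec (Ranking k) n

SCF : ℕ → ℕ → Set
SCF n k = Profile n k → Fin k

allVecsOf : ∀ {A : Set} → List A → (m : ℕ) → List (Vec A m)
allVecsOf xs zero = [] ∷ []
allVecsOf xs (suc m) = concatMap (λ x → List.map (x ∷_) (allVecsOf xs m)) xs

toRanking : ∀ {k} → Vec (Fin k) k → Maybe (Ranking k)
toRanking v with T? (isPerm v)
... | yes p = just (v , p)
... | no _ = nothing

allRankings : (k : ℕ) → List (Ranking k)
allRankings k = List.mapMaybe toRanking (allVecsOf (List.allFin k) k)

allProfiles : (n k : ℕ) → List (Profile n k)
allProfiles n k = allVecsOf (allRankings k) n

frac : ℕ → ℕ → ℚ
frac a zero = 0ℚ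
frac a (suc b) = (+ a) / suc b

Prob : ∀ {n k} {P : Pred (Profile n k) Agda.Primitive.lzero} → Decidable P → ℚ
Prob {n} {k} P? = frac (length (filter P? (allProfiles n k))) (length (allProfiles n k))

D : ∀ {n k} → SCF n k → SCF n k → ℚ
D f g = Prob (λ σ → ¬? (f σ ≟ g σ))
  where open import Relation.Nullary.Decidable using (¬?)

Manip : ∀ {n k} → SCF n k → Profile n k → Set
Manip {n} {k} f σ = ∃ λ (i : Fin n) →
  Any (λ τ → f (σ [ i ]≔ τ) >[ lookup σ i ] f σ) (allRankings k)

-- τ is obtained from ρ by permuting at most r alternatives in adjacent
-- positions: there is a window of r consecutive positions starting at j
-- outside of which τ and ρ agree.
Window : ∀ {k} → ℕ → Fin k → Fin k → Set
Window r j p = Data.Fin.toℕ j ℕ.≤ Data.Fin.toℕ p × Data.Fin.toℕ p ℕ.< Data.Fin.toℕ j ℕ.+ r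

window? : ∀ {k} r (j p : Fin k) → Dec (Window r j p)
window? r j p = (Data.Fin.toℕ j ℕ.≤? Data.Fin.toℕ p) ×-dec (Data.Fin.toℕ p ℕ.<? Data.Fin.toℕ j ℕ.+ r)

AdjPerm : ∀ {k} → ℕ → Ranking k → Ranking k → Set
AdjPerm {k} r ρ τ = ∃ λ (j : Fin k) → ∀ (p : Fin k) →
  Window r j p ⊎ lookup (proj₁ τ) p ≡ lookup (proj₁ ρ) p

ManipR : ∀ {n k} → ℕ → SCF n k → Profile n k → Set
ManipR {n} {k} r f σ = ∃ λ (i : Fin n) →
  Any (λ τ → AdjPerm r (lookup σ i) τ × f (σ [ i ]≔ τ) >[ lookup σ i ] f σ) (allRankings k)

open import Data.List.Relation.Unary.Any using () renaming (any? to anyL?)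
open import Relation.Nullary.Decidable using (_⊎-dec_)

manip? : ∀ {n k} (f : SCF n k) → Decidable (Manip f)
manip? f σ = any? (λ i → anyL?
  (λ τ → above? (proj₁ (lookup σ i)) (f (σ [ i ]≔ τ)) (f σ)) (allRankings _))

manipR? : ∀ {n k} r (f : SCF n k) → Decidable (ManipR r f)
manipR? r f σ = any? (λ i → anyL?
  (λ τ → any? (λ j → all? (λ p → window? r j p ⊎-dec (lookup (proj₁ τ) p ≟ lookup (proj₁ (lookup σ i)) p)))
         ×-dec above? (proj₁ (lookup σ i)) (f (σ [ i ]≔ τ)) (f σ)) (allRankings _))

topL : ∀ {k} → Subset k → List (Fin k) → Maybe (Fin k)
topL H [] = nothing
topL H (x ∷ xs) with x ∈? H
... | yes _ = just x
... | no _ = topL H xs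

top : ∀ {k} → Subset k → Ranking k → Maybe (Fin k)
top H r = topL H (Vec.toList (proj₁ r))

TwoValued : ∀ {n k} → SCF n k → Set
TwoValued {n} {k} f = ∃ λ (a : Fin k) → ∃ λ (b : Fin k) → a ≢ b ×
  (∀ σ → f σ ≡ a ⊎ f σ ≡ b) × (∃ λ σ → f σ ≡ a) × (∃ λ σ → f σ ≡ b)

Monotone : ∀ {n k} → SCF n k → Set
Monotone {n} {k} f = ∀ (σ : Profile n k) (i : Fin n) (τ : Ranking k) →
  f σ ≢ f (σ [ i ]≔ τ) →
  (f σ >[ lookup σ i ] f (σ [ i ]≔ τ)) × (f (σ [ i ]≔ τ) >[ τ ] f σ)

NONMANIP : ∀ {n k} → SCF n k → Set
NONMANIP {n} {k} g =
  (∃ λ (i : Fin n) → ∃ λ (H : Subset k) → Nonempty H × (∀ σ → just (g σ) ≡ top H (lookup σ i)))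
  ⊎ (Monotone g × TwoValued g)

NONMANIP̄ : ∀ {n k} → SCF n k → Set
NONMANIP̄ {n} {k} g =
  (∃ λ (i : Fin n) → ∀ σ σ' → lookup σ i ≡ lookup σ' i → g σ ≡ g σ')
  ⊎ (∃ λ (a : Fin k) → ∃ λ (b : Fin k) → ∀ σ → g σ ≡ a ⊎ g σ ≡ b)

{-# OPTIONS --safe #-}

-- Any two rankings are joined by at most k² adjacent transpositions, each of which
-- moves the pair it exchanges into its final order.  If no profile on such a path is a
-- local manipulation point, the outcome can only climb in the final ranking, so a voter
-- replacing a ranking by a uniformly random one gains with probability at most
-- 2k² P(M₃(f)).  This bound passes to the nearby g in NONMANIP̄.  If g depends on voter i
-- only, then independence gives P(g = b) P(b > g(σ)) ≤ ε with ε = O(k²α), so g is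
-- close to top_H for H = {b : P(g = b) > √ε}.  If g takes only the values a and b, then
-- for each voter in turn g is read off at a random ranking r and its image under a ↔ b
-- and the two values are sorted; this makes g exactly monotone in that voter, and on
-- average creates no violations for the other voters.
module Submission where

open import Defs
open import Algebra.Properties.CommutativeSemigroup using (interchange; x∙yz≈y∙xz)
open import Data.Bool using (Bool; true; false; not; _∧_; _∨_; if_then_else_; T?)
open import Data.Bool.Properties using (T-irrelevant)
open import Data.Fin as Fin using (Fin; zero; suc)
open import Data.Fin.Permutation.Components using (transpose; transpose-inverse)
import Data.Fin.Properties as Fin
open import Data.Fin.Subset as Subset using (Subset; Nonempty; ⁅_⁆)
open import Data.Fin.Subset.Properties using (_∈?_; nonempty?; x∈⁅x⁆; x∈⁅y⁆⇒x≡y)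
import Data.Integer as ℤ
import Data.Integer.Properties as ℤ
open import Data.List as List using (List; []; _∷_; _++_; length)
import Data.List.Membership.Propositional as List
import Data.List.Membership.Propositional.Properties as List
open import Data.List.Properties using (length-++; length-map; length-tabulate)
import Data.List.Relation.Unary.All as All
import Data.List.Relation.Unary.All.Properties as All
open import Data.List.Relation.Unary.AllPairs using ([]; _∷_)
open import Data.List.Relation.Unary.Any as ListAny using (here; there)
import Data.List.Relation.Unary.Any.Properties as ListAny
import Data.List.Relation.Unary.Unique.Propositional as List
import Data.List.Relation.Unary.Unique.Propositional.Properties as ListUnique
open import Data.Maybe using (just; nothing)
import Data.Maybe.Relation.Unary.All as MAll
import Data.Maybe.Relation.Unary.Any as MAny
open import Data.Nat as ℕ using (ℕ; zero; suc; _+_; _*_; _^_; _∸_; _⊔_; _≤_; _<_; _≤?_; _<?_; z≤n; s≤s)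
open import Data.Nat.Properties
open import Data.Nat.Tactic.RingSolver using (solve-∀)
open import Data.Product using (∃; _×_; _,_; proj₁; proj₂)
open import Data.Rational as ℚ using (ℚ; 0ℚ; toℚᵘ)
import Data.Rational.Properties as ℚ
open import Data.Rational.Unnormalised as ℚᵘ using (mkℚᵘ; *≤*; *<*)
import Data.Rational.Unnormalised.Properties as ℚᵘ
open import Data.Sum using (_⊎_; inj₁; inj₂)
open import Data.Vec as Vec using (Vec; []; _∷_; lookup; _[_]≔_)
open import Data.Vec.Membership.Propositional using (_∈_)
open import Data.Vec.Membership.Propositional.Properties using (∈-lookup; ∈-map⁺; ∈-allFin⁺)
open import Data.Vec.Properties
  using ( ∷-injective; map-∘; map-cong; map-id; map-lookup-allFin; tabulate∘lookup; lookup∘tabulate; lookup⇒[]=; []=⇒lookup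
        ; []≔-lookup; []≔-idempotent; []≔-commutes; lookup∘update; lookup∘update′)
import Data.Vec.Relation.Unary.All as VAll
import Data.Vec.Relation.Unary.All.Properties as VAll
open import Data.Vec.Relation.Unary.AllPairs as AllPairs using ([]; _∷_)
open import Data.Vec.Relation.Unary.Any as Any using (here; there)
open import Data.Vec.Relation.Unary.Any.Properties using (lookup-index)
open import Data.Vec.Relation.Unary.Unique.Propositional using (Unique)
import Data.Vec.Relation.Unary.Unique.Propositional.Properties as VecUnique
open import Function using (_∘_)
open import Relation.Binary.PropositionalEquality
open import Relation.Nullary using (Dec; yes; no; ¬_; contradiction; ¬?; does)
open import Relation.Nullary.Decidable using (toWitness; fromWitness; dec-true; dec-false; from-yes; map′; _×-dec_; toSum)
open import Relation.Unary using (Pred; Decidable)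

-- The path between two rankings has to be chosen so that its intermediate rankings are uniformly
-- distributed. A random new ranking is therefore written as `r ⊚ ω`, where ω is uniform and
-- independent of the old ranking `r`, and the word of swaps depends on ω alone; each prefix of the
-- word then acts as a bijection on rankings. In the two-valued case the danger is a loss at every
-- voter: repairing one voter disturbs the others, and a constant factor would compound to an
-- exponential in `n`. Sorting the values at a ranking and at its a ↔ b image avoids this, since
-- minimum and maximum together drop no more often than the two original values. Both cases yield
-- more than a cube root, namely a square root bound and a linear bound, and 100 n⁴k⁸ absorbs all
-- losses. Probabilities are kept as integer counts with denominators cleared until the end.

private variable
  A B X Y : Set
  k n p   : ℕ

-- Finite sums and indicators

infix 5 ∑
∑ : List A → (A → ℕ) → ℕ
∑ []       φ = 0
∑ (x ∷ xs) φ = φ x + ∑ xs φ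

syntax ∑ xs (λ x → e) = ∑[ x ∈ xs ] e

∑-cong : ∀ (xs : List A) {φ ψ : A → ℕ} → (∀ x → φ x ≡ ψ x) → ∑ xs φ ≡ ∑ xs ψ
∑-cong []       eq = refl
∑-cong (x ∷ xs) eq = cong₂ _+_ (eq x) (∑-cong xs eq)

∑-mono : ∀ (xs : List A) {φ ψ : A → ℕ} → (∀ x → φ x ≤ ψ x) → ∑ xs φ ≤ ∑ xs ψ
∑-mono []       le = z≤n
∑-mono (x ∷ xs) le = +-mono-≤ (le x) (∑-mono xs le)

∑-+ : ∀ (xs : List A) (φ ψ : A → ℕ) → (∑[ x ∈ xs ] (φ x + ψ x)) ≡ ∑ xs φ + ∑ xs ψ
∑-+ []       φ ψ = refl
∑-+ (x ∷ xs) φ ψ = begin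
  φ x + ψ x + ∑ xs (λ y → φ y + ψ y)  ≡⟨ cong (φ x + ψ x +_) (∑-+ xs φ ψ) ⟩
  φ x + ψ x + (∑ xs φ + ∑ xs ψ)       ≡⟨ interchange +-commutativeSemigroup (φ x) (ψ x) (∑ xs φ) (∑ xs ψ) ⟩
  φ x + ∑ xs φ + (ψ x + ∑ xs ψ)       ∎
  where open ≡-Reasoning

∑-const : ∀ (xs : List A) c → (∑[ x ∈ xs ] c) ≡ length xs * c
∑-const []       c = refl
∑-const (x ∷ xs) c = cong (c +_) (∑-const xs c)

∑-bounded : ∀ (xs : List A) {φ : A → ℕ} {c} → (∀ x → φ x ≤ c) → ∑ xs φ ≤ length xs * c
∑-bounded xs le = ≤-trans (∑-mono xs le) (≤-reflexive (∑-const xs _))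

∑-*ˡ : ∀ (xs : List A) c (φ : A → ℕ) → (∑[ x ∈ xs ] c * φ x) ≡ c * ∑ xs φ
∑-*ˡ []       c φ = sym (*-zeroʳ c)
∑-*ˡ (x ∷ xs) c φ = trans (cong (c * φ x +_) (∑-*ˡ xs c φ)) (sym (*-distribˡ-+ c (φ x) (∑ xs φ)))

∑-*ʳ : ∀ (xs : List A) c (φ : A → ℕ) → (∑[ x ∈ xs ] φ x * c) ≡ ∑ xs φ * c
∑-*ʳ xs c φ = trans (∑-cong xs λ x → *-comm (φ x) c) (trans (∑-*ˡ xs c φ) (*-comm c _))

∑-swap : ∀ (xs : List A) (ys : List B) (φ : A → B → ℕ) →
  (∑[ x ∈ xs ] ∑[ y ∈ ys ] φ x y) ≡ (∑[ y ∈ ys ] ∑[ x ∈ xs ] φ x y)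
∑-swap []       ys φ = sym (trans (∑-const ys 0) (*-zeroʳ (length ys)))
∑-swap (x ∷ xs) ys φ = begin
  ∑ ys (φ x) + (∑[ x ∈ xs ] ∑[ y ∈ ys ] φ x y)  ≡⟨ cong (∑ ys (φ x) +_) (∑-swap xs ys φ) ⟩
  ∑ ys (φ x) + (∑[ y ∈ ys ] ∑[ x ∈ xs ] φ x y)  ≡⟨ ∑-+ ys (φ x) _ ⟨
  (∑[ y ∈ ys ] (φ x y + (∑[ x ∈ xs ] φ x y)))   ∎
  where open ≡-Reasoning

∑-++ : ∀ (xs ys : List A) (φ : A → ℕ) → ∑ (xs ++ ys) φ ≡ ∑ xs φ + ∑ ys φ
∑-++ []       ys φ = refl
∑-++ (x ∷ xs) ys φ = trans (cong (φ x +_) (∑-++ xs ys φ)) (sym (+-assoc (φ x) _ _))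

∑-map : ∀ (xs : List A) (s : A → B) (φ : B → ℕ) → ∑ (List.map s xs) φ ≡ ∑ xs (λ x → φ (s x))
∑-map []       s φ = refl
∑-map (x ∷ xs) s φ = cong (φ (s x) +_) (∑-map xs s φ)

∑-concatMap : ∀ (xs : List A) (s : A → List B) (φ : B → ℕ) →
  ∑ (List.concatMap s xs) φ ≡ (∑[ x ∈ xs ] ∑ (s x) φ)
∑-concatMap []       s φ = refl
∑-concatMap (x ∷ xs) s φ = trans (∑-++ (s x) _ φ) (cong (∑ (s x) φ +_) (∑-concatMap xs s φ))

∈⇒≤∑ : ∀ {xs : List A} {x} (φ : A → ℕ) → x List.∈ xs → φ x ≤ ∑ xs φ
∈⇒≤∑ φ (here refl) = m≤m+n _ _
∈⇒≤∑ φ (there x∈)  = ≤-trans (∈⇒≤∑ φ x∈) (m≤n+m _ _)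

-- Removing one occurrence of the head of `xs` from `ys` keeps the rest of `xs` covered, because the
-- head does not recur there.
∑-⊆ : ∀ {xs ys : List A} (φ : A → ℕ) → List.Unique xs → (∀ {x} → x List.∈ xs → x List.∈ ys) → ∑ xs φ ≤ ∑ ys φ
∑-⊆ {xs = []} φ _ _ = z≤n
∑-⊆ {xs = x ∷ xs} φ (x∉ ∷ u) xs⊆ with List.∈-∃++ (xs⊆ (here refl))
... | as , bs , refl = begin
  φ x + ∑ xs φ             ≤⟨ +-monoʳ-≤ (φ x) (∑-⊆ φ u rest) ⟩
  φ x + ∑ (as ++ bs) φ     ≡⟨ cong (φ x +_) (∑-++ as bs φ) ⟩
  φ x + (∑ as φ + ∑ bs φ)  ≡⟨ x∙yz≈y∙xz +-commutativeSemigroup (φ x) (∑ as φ) (∑ bs φ) ⟩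
  ∑ as φ + (φ x + ∑ bs φ)  ≡⟨ ∑-++ as (x ∷ bs) φ ⟨
  ∑ (as ++ x ∷ bs) φ       ∎
  where
  open ≤-Reasoning
  rest : ∀ {z} → z List.∈ xs → z List.∈ as ++ bs
  rest z∈ with List.∈-++⁻ as (xs⊆ (there z∈))
  ... | inj₁ z∈as         = List.∈-++⁺ˡ z∈as
  ... | inj₂ (here refl)  = contradiction refl (All.lookup x∉ z∈)
  ... | inj₂ (there z∈bs) = List.∈-++⁺ʳ as z∈bs

module _ {xs : List A} (unique : List.Unique xs) (complete : ∀ x → x List.∈ xs) where

  -- The list of images contains every element, hence covers the duplicate-free `xs`, and all terms
  -- are nonnegative.
  ∑-surjective : ∀ (s : A → A) → (∀ y → ∃ λ x → s x ≡ y) → ∀ φ → ∑ xs φ ≤ ∑ xs (λ x → φ (s x))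
  ∑-surjective s surj φ = ≤-trans (∑-⊆ φ unique λ {y} _ → in-image y) (≤-reflexive (∑-map xs s φ))
    where
    in-image : ∀ y → y List.∈ List.map s xs
    in-image y with surj y
    ... | x , refl = List.∈-map⁺ s (complete x)

  ∑-involution : ∀ (s : A → A) → (∀ x → s (s x) ≡ x) → ∀ φ → ∑ xs (λ x → φ (s x)) ≡ ∑ xs φ
  ∑-involution s inv φ = ≤-antisym
    (≤-trans (∑-surjective s surj _) (≤-reflexive (∑-cong xs λ x → cong φ (inv x))))
    (∑-surjective s surj φ)
    where
    surj : ∀ y → ∃ λ x → s x ≡ y
    surj y = s y , inv y

𝟙 : Dec X → ℕ
𝟙 d = if does d then 1 else 0

𝟙-yes : (d : Dec X) → X → 𝟙 d ≡ 1
𝟙-yes (yes _) _ = refl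
𝟙-yes (no ¬x) x = contradiction x ¬x

𝟙≤ : (d : Dec X) {c : ℕ} → (X → 1 ≤ c) → 𝟙 d ≤ c
𝟙≤ (yes x) f = f x
𝟙≤ (no _)  f = z≤n

𝟙≤1 : (d : Dec X) → 𝟙 d ≤ 1
𝟙≤1 (yes _) = ≤-refl
𝟙≤1 (no _)  = z≤n

𝟙-mono : (d : Dec X) (e : Dec Y) → (X → Y) → 𝟙 d ≤ 𝟙 e
𝟙-mono d e f = 𝟙≤ d λ x → ≤-reflexive (sym (𝟙-yes e (f x)))

𝟙-⊎ : (d : Dec X) (e : Dec Y) → X ⊎ Y → 1 ≤ 𝟙 d + 𝟙 e
𝟙-⊎ d e (inj₁ x) = ≤-trans (≤-reflexive (sym (𝟙-yes d x))) (m≤m+n _ _)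
𝟙-⊎ d e (inj₂ y) = ≤-trans (≤-reflexive (sym (𝟙-yes e y))) (m≤n+m _ _)

length-filter≡∑ : ∀ {P : Pred A _} (P? : Decidable P) xs →
  length (List.filter P? xs) ≡ (∑[ x ∈ xs ] 𝟙 (P? x))
length-filter≡∑ P? [] = refl
length-filter≡∑ P? (x ∷ xs) with does (P? x)
... | true  = cong suc (length-filter≡∑ P? xs)
... | false = length-filter≡∑ P? xs

-- Rankings

ranking-ext : {r r' : Ranking k} → proj₁ r ≡ proj₁ r' → r ≡ r'
ranking-ext {r = v , perm} {.v , perm'} refl = cong (v ,_) (T-irrelevant perm perm')

ranking : (v : Vec (Fin k) k) → (∀ a → a ∈ v) → Ranking k
ranking v surj = v , fromWitness λ a → Any.index (surj a) , sym (lookup-index (surj a))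

ranking-∈ : ∀ (r : Ranking k) a → a ∈ proj₁ r
ranking-∈ (v , perm) a with toWitness perm a
... | p , refl = ∈-lookup p v

-- Pigeonhole. The map `position` is injective, being inverted by `lookup v`. A `p` different from
-- `position (lookup v p)` is not in its range, and punching it out would inject `Fin (suc k)` into
-- `Fin k`.
surjective⇒unique : (v : Vec (Fin k) k) → (∀ a → a ∈ v) → Unique v
surjective⇒unique {zero}  [] surj = []
surjective⇒unique {suc k} v  surj = subst Unique (tabulate∘lookup v) (VecUnique.tabulate⁺ injective)
  where
  position : Fin (suc k) → Fin (suc k)
  position a = Any.index (surj a)

  lookup-position : ∀ a → lookup v (position a) ≡ a
  lookup-position a = sym (lookup-index (surj a))

  position-surjective : ∀ p → position (lookup v p) ≡ p
  position-surjective p with p Fin.≟ position (lookup v p)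
  ... | yes eq = sym eq
  ... | no neq = contradiction (Fin.injective⇒≤ avoiding-injective) 1+n≰n
    where
    avoids : ∀ b → p ≢ position b
    avoids b refl = neq (cong position (sym (lookup-position b)))

    avoiding-injective : ∀ {b c} → Fin.punchOut (avoids b) ≡ Fin.punchOut (avoids c) → b ≡ c
    avoiding-injective {b} {c} eq = trans (sym (lookup-position b)) (trans
      (cong (lookup v) (Fin.punchOut-injective (avoids b) (avoids c) eq)) (lookup-position c))

  injective : ∀ {p q} → lookup v p ≡ lookup v q → p ≡ q
  injective {p} {q} eq = trans (sym (position-surjective p)) (trans (cong position eq) (position-surjective q))

ranking-unique : (r : Ranking k) → Unique (proj₁ r)
ranking-unique r = surjective⇒unique (proj₁ r) (ranking-∈ r)

concatMap≡cartesianProductWith : ∀ {C : Set} (f : A → B → C) xs ys →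
  List.concatMap (λ x → List.map (f x) ys) xs ≡ List.cartesianProductWith f xs ys
concatMap≡cartesianProductWith f []       ys = refl
concatMap≡cartesianProductWith f (x ∷ xs) ys =
  cong (List.map (f x) ys List.++_) (concatMap≡cartesianProductWith f xs ys)

module _ {xs : List A} where

  allVecsOf-complete : (∀ x → x List.∈ xs) → ∀ (v : Vec A n) → v List.∈ allVecsOf xs n
  allVecsOf-complete complete []      = ListAny.here refl
  allVecsOf-complete complete (x ∷ v) = subst ((x ∷ v) List.∈_)
    (sym (concatMap≡cartesianProductWith _∷_ xs _))
    (List.∈-cartesianProductWith⁺ _∷_ (complete x) (allVecsOf-complete complete v))

  allVecsOf-unique : List.Unique xs → ∀ n → List.Unique (allVecsOf xs n)
  allVecsOf-unique unique zero    = All.[] ∷ []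
  allVecsOf-unique unique (suc n) = subst List.Unique
    (sym (concatMap≡cartesianProductWith _∷_ xs _))
    (ListUnique.cartesianProductWith⁺ _∷_ ∷-injective unique (allVecsOf-unique unique n))

toRanking-just : ∀ (r : Ranking k) → toRanking (proj₁ r) ≡ just r
toRanking-just (v , perm) with T? (isPerm v)
... | yes _ = cong just (ranking-ext refl)
... | no ¬perm = contradiction perm ¬perm

toRanking-proj₁ : ∀ (v : Vec (Fin k) k) {r} → toRanking v ≡ just r → proj₁ r ≡ v
toRanking-proj₁ v eq with T? (isPerm v) | eq
... | yes _ | refl = refl

allRankings-complete : ∀ (r : Ranking k) → r List.∈ allRankings k
allRankings-complete {k} r = ListAny.mapMaybe⁺ toRanking _ (ListAny.map⁺ (ListAny.map
  {Q = λ v → MAny.Any (r ≡_) (toRanking v)} (λ { refl → contains-r })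
  (allVecsOf-complete List.∈-allFin (proj₁ r))))
  where
  contains-r : MAny.Any (r ≡_) (toRanking (proj₁ r))
  contains-r rewrite toRanking-just r = MAny.just refl

mapMaybe-toRanking-unique : ∀ {vs : List (Vec (Fin k) k)} → List.Unique vs → List.Unique (List.mapMaybe toRanking vs)
mapMaybe-toRanking-unique [] = []
mapMaybe-toRanking-unique {vs = v ∷ vs} (v∉ ∷ u) with toRanking v in eq
... | nothing = mapMaybe-toRanking-unique u
... | just r  = All.mapMaybe⁺ (All.map⁺ (All.map distinct v∉)) ∷ mapMaybe-toRanking-unique u
  where
  distinct : ∀ {w} → v ≢ w → MAll.All (r ≢_) (toRanking w)
  distinct {w} v≢w with toRanking w in eq'
  ... | nothing = MAll.nothing
  ... | just r' = MAll.just λ { refl → v≢w (trans (sym (toRanking-proj₁ v eq)) (toRanking-proj₁ w eq')) }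

allRankings-unique : ∀ k → List.Unique (allRankings k)
allRankings-unique k = mapMaybe-toRanking-unique (allVecsOf-unique (ListUnique.allFin⁺ k) k)

-- The inductive form of `Above`, for vectors of any length: arguments about swaps and sorting can
-- recurse on the vector instead of comparing positions.
data Before {A : Set} : ∀ {n} → Vec A n → A → A → Set where
  here  : ∀ {a b} {xs : Vec A n} → b ∈ xs → Before (a ∷ xs) a b
  there : ∀ {a b x} {xs : Vec A n} → Before xs a b → Before (x ∷ xs) a b

Before⇒∈ˡ : ∀ {v : Vec A n} {a b} → Before v a b → a ∈ v
Before⇒∈ˡ (here _)  = here refl
Before⇒∈ˡ (there h) = there (Before⇒∈ˡ h)

Before⇒∈ʳ : ∀ {v : Vec A n} {a b} → Before v a b → b ∈ v
Before⇒∈ʳ (here b∈) = there b∈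
Before⇒∈ʳ (there h) = there (Before⇒∈ʳ h)

Before-asym : ∀ {v : Vec A n} {a b} → Unique v → Before v a b → ¬ Before v b a
Before-asym (x∉ ∷ u) (here b∈) (here a∈)  = VAll.lookup x∉ a∈ refl
Before-asym (x∉ ∷ u) (here b∈) (there h)  = VAll.lookup x∉ (Before⇒∈ʳ h) refl
Before-asym (x∉ ∷ u) (there h) (here _)   = VAll.lookup x∉ (Before⇒∈ʳ h) refl
Before-asym (x∉ ∷ u) (there h) (there h') = Before-asym u h h'

Before-trans : ∀ {v : Vec A n} {a b c} → Unique v → Before v a b → Before v b c → Before v a c
Before-trans (x∉ ∷ u) (here b∈) (here c∈)  = here c∈
Before-trans (x∉ ∷ u) (here b∈) (there h)  = here (Before⇒∈ʳ h)
Before-trans (x∉ ∷ u) (there h) (here c∈)  = contradiction refl (VAll.lookup x∉ (Before⇒∈ʳ h))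
Before-trans (x∉ ∷ u) (there h) (there h') = there (Before-trans u h h')

Before-total : ∀ {v : Vec A n} {a b} → a ∈ v → b ∈ v → a ≢ b → Before v a b ⊎ Before v b a
Before-total (here refl) (here refl) a≢b = contradiction refl a≢b
Before-total (here refl) (there b∈)  a≢b = inj₁ (here b∈)
Before-total (there a∈)  (here refl) a≢b = inj₂ (here a∈)
Before-total (there a∈)  (there b∈)  a≢b with Before-total a∈ b∈ a≢b
... | inj₁ h = inj₁ (there h)
... | inj₂ h = inj₂ (there h)

Before-map : ∀ (f : A → B) {v : Vec A n} {a b} → Before v a b → Before (Vec.map f v) (f a) (f b)
Before-map f (here b∈) = here (∈-map⁺ f b∈)
Before-map f (there h) = there (Before-map f h)

lookup⇒Before : ∀ (v : Vec A n) {p q} → p Fin.< q → Before v (lookup v p) (lookup v q)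
lookup⇒Before (x ∷ v) {zero}  {suc q} p<q       = here (∈-lookup q v)
lookup⇒Before (x ∷ v) {suc p} {suc q} (s≤s p<q) = there (lookup⇒Before v p<q)

Before⇒lookup : ∀ {v : Vec A n} {a b} → Before v a b →
  ∃ λ (p : Fin n) → ∃ λ (q : Fin n) → p Fin.< q × lookup v p ≡ a × lookup v q ≡ b
Before⇒lookup (here b∈) = zero , suc (Any.index b∈) , s≤s z≤n , refl , sym (lookup-index b∈)
Before⇒lookup (there h) with Before⇒lookup h
... | p , q , p<q , eq , eq' = suc p , suc q , s≤s p<q , eq , eq'

Above⇒Before : ∀ {v : Vec (Fin k) k} {a b} → Above v a b → Before v a b
Above⇒Before (p , q , p<q , refl , refl) = lookup⇒Before _ p<q

>-asym : ∀ (r : Ranking k) {a b} → a >[ r ] b → ¬ b >[ r ] a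
>-asym r h h' = Before-asym (ranking-unique r) (Above⇒Before h) (Above⇒Before h')

>-total : ∀ (r : Ranking k) {a b} → a ≢ b → a >[ r ] b ⊎ b >[ r ] a
>-total r {a} {b} a≢b with Before-total (ranking-∈ r a) (ranking-∈ r b) a≢b
... | inj₁ h = inj₁ (Before⇒lookup h)
... | inj₂ h = inj₂ (Before⇒lookup h)

relabel : ∀ (π π⁻¹ : Fin k → Fin k) → (∀ a → π (π⁻¹ a) ≡ a) → Ranking k → Ranking k
relabel π π⁻¹ inv r = ranking (Vec.map π (proj₁ r)) λ a →
  subst (_∈ _) (inv a) (∈-map⁺ π (ranking-∈ r (π⁻¹ a)))

-- Here `s` is read as a permutation of positions: position `q` of the result holds the alternative
-- that `r` has at position `lookup (proj₁ s) q`.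
_⊚_ : Ranking k → Ranking k → Ranking k
r ⊚ s = ranking (Vec.map (lookup (proj₁ r)) (proj₁ s)) λ a →
  subst (_∈ _) (sym (lookup-index (ranking-∈ r a))) (∈-map⁺ (lookup (proj₁ r)) (ranking-∈ s _))

⊚-surjective : ∀ (r t : Ranking k) → ∃ λ s → r ⊚ s ≡ t
⊚-surjective {k} r t = relative , ranking-ext (begin
  Vec.map (lookup (proj₁ r)) (Vec.map position (proj₁ t))  ≡⟨ map-∘ _ _ (proj₁ t) ⟨
  Vec.map (lookup (proj₁ r) ∘ position) (proj₁ t)          ≡⟨ map-cong lookup-position (proj₁ t) ⟩
  Vec.map (λ a → a) (proj₁ t)                              ≡⟨ map-id (proj₁ t) ⟩
  proj₁ t                                                  ∎)
  where
  open ≡-Reasoning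
  position : Fin k → Fin k
  position a = Any.index (ranking-∈ r a)

  lookup-position : ∀ a → lookup (proj₁ r) (position a) ≡ a
  lookup-position a = sym (lookup-index (ranking-∈ r a))

  injective : ∀ {p q} → lookup (proj₁ r) p ≡ lookup (proj₁ r) q → p ≡ q
  injective = VecUnique.lookup-injective (ranking-unique r) _ _

  relative : Ranking k
  relative = relabel position (lookup (proj₁ r)) (λ p → injective (lookup-position _)) t

-- Exchanges positions p and p + 1; the identity if these are not both positions.
swapAt : ℕ → Vec A n → Vec A n
swapAt zero    (x ∷ y ∷ v) = y ∷ x ∷ v
swapAt (suc p) (x ∷ v)     = x ∷ swapAt p v
swapAt _       v           = v

swapAt-involutive : ∀ p (v : Vec A n) → swapAt p (swapAt p v) ≡ v
swapAt-involutive zero    []          = refl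
swapAt-involutive zero    (x ∷ [])    = refl
swapAt-involutive zero    (x ∷ y ∷ v) = refl
swapAt-involutive (suc p) []          = refl
swapAt-involutive (suc p) (x ∷ v)     = cong (x ∷_) (swapAt-involutive p v)

∈-swapAt : ∀ p {v : Vec A n} {a} → a ∈ v → a ∈ swapAt p v
∈-swapAt zero    {x ∷ []}    a∈                 = a∈
∈-swapAt zero    {x ∷ y ∷ v} (here eq)          = there (here eq)
∈-swapAt zero    {x ∷ y ∷ v} (there (here eq))  = here eq
∈-swapAt zero    {x ∷ y ∷ v} (there (there a∈)) = there (there a∈)
∈-swapAt (suc p) {x ∷ v}     (here eq)          = here eq
∈-swapAt (suc p) {x ∷ v}     (there a∈)         = there (∈-swapAt p a∈)

swapRanking : ℕ → Ranking k → Ranking k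
swapRanking p r = ranking (swapAt p (proj₁ r)) λ a → ∈-swapAt p (ranking-∈ r a)

swapRanking-involutive : ∀ p (r : Ranking k) → swapRanking p (swapRanking p r) ≡ r
swapRanking-involutive p r = ranking-ext (swapAt-involutive p (proj₁ r))

lookup-swapAt : ∀ p (v : Vec A n) q → (p ≤ Fin.toℕ q × Fin.toℕ q ℕ.< p + 3) ⊎ lookup (swapAt p v) q ≡ lookup v q
lookup-swapAt zero    (x ∷ [])    q             = inj₂ refl
lookup-swapAt zero    (x ∷ y ∷ v) zero          = inj₁ (z≤n , s≤s z≤n)
lookup-swapAt zero    (x ∷ y ∷ v) (suc zero)    = inj₁ (z≤n , s≤s (s≤s z≤n))
lookup-swapAt zero    (x ∷ y ∷ v) (suc (suc q)) = inj₂ refl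
lookup-swapAt (suc p) (x ∷ v)     zero          = inj₂ refl
lookup-swapAt (suc p) (x ∷ v)     (suc q) with lookup-swapAt p v q
... | inj₁ (le , lt) = inj₁ (s≤s le , s≤s lt)
... | inj₂ eq        = inj₂ eq

swapAt-out-of-range : ∀ p (v : Vec A n) → n ≤ p → swapAt p v ≡ v
swapAt-out-of-range zero    []      _         = refl
swapAt-out-of-range (suc p) []      _         = refl
swapAt-out-of-range (suc p) (x ∷ v) (s≤s n≤p) = cong (x ∷_) (swapAt-out-of-range p v n≤p)

swapRanking-AdjPerm : ∀ p (r : Ranking (suc k)) → AdjPerm 3 r (swapRanking p r)
swapRanking-AdjPerm {k} p r with p ℕ.<? suc k
... | yes p<k = Fin.fromℕ< p<k , λ q → subst
  (λ j → (j ≤ Fin.toℕ q × Fin.toℕ q ℕ.< j + 3) ⊎ lookup (swapAt p (proj₁ r)) q ≡ lookup (proj₁ r) q)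
  (sym (Fin.toℕ-fromℕ< p<k)) (lookup-swapAt p (proj₁ r) q)
-- Out of range the swap is the identity, so any window start will do.
... | no p≮k = zero , λ q → inj₂ (cong (λ v → lookup v q) (swapAt-out-of-range p (proj₁ r) (≮⇒≥ p≮k)))

data Swap {A : Set} (c d : A) : ∀ {n} → ℕ → Vec A n → Vec A n → Set where
  here  : ∀ {v : Vec A n} → Swap c d zero (c ∷ d ∷ v) (d ∷ c ∷ v)
  there : ∀ {x} {u v : Vec A n} → Swap c d p u v → Swap c d (suc p) (x ∷ u) (x ∷ v)

Swap⇒swapAt : ∀ {c d : A} {u v : Vec A n} → Swap c d p u v → swapAt p u ≡ v
Swap⇒swapAt here      = refl
Swap⇒swapAt (there s) = cong (_ ∷_) (Swap⇒swapAt s)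

Swap-sym : ∀ {c d : A} {u v : Vec A n} → Swap c d p u v → Swap d c p v u
Swap-sym here      = here
Swap-sym (there s) = there (Swap-sym s)

Swap-map : ∀ (f : A → B) {c d} {u v : Vec A n} → Swap c d p u v → Swap (f c) (f d) p (Vec.map f u) (Vec.map f v)
Swap-map f here      = here
Swap-map f (there s) = there (Swap-map f s)

Swap-∈ : ∀ {c d a : A} {u v : Vec A n} → Swap c d p u v → a ∈ u → a ∈ v
Swap-∈ {p = p} {a = a} s a∈ = subst (a ∈_) (Swap⇒swapAt s) (∈-swapAt p a∈)

Swap⇒Before : ∀ {c d : A} {u v : Vec A n} → Swap c d p u v → Before u c d
Swap⇒Before here      = here (here refl)
Swap⇒Before (there s) = there (Swap⇒Before s)

Before-Swap : ∀ {c d a b : A} {u v : Vec A n} → Swap c d p u v → Before u a b → (a ≡ c × b ≡ d) ⊎ Before v a b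
Before-Swap here      (here (here refl))     = inj₁ (refl , refl)
Before-Swap here      (here (there b∈))      = inj₂ (there (here b∈))
Before-Swap here      (there (here b∈))      = inj₂ (here (there b∈))
Before-Swap here      (there (there h))      = inj₂ (there (there h))
Before-Swap (there s) (here b∈)              = inj₂ (here (Swap-∈ s b∈))
Before-Swap (there s) (there h) with Before-Swap s h
... | inj₁ eqs = inj₁ eqs
... | inj₂ h'  = inj₂ (there h')

-- Sorting by adjacent transpositions

-- R d c has to hold whenever d overtakes c.
data Steps {A : Set} (R : A → A → Set) : ∀ {n} → List ℕ → Vec A n → Vec A n → Set where
  done : ∀ {u : Vec A n} → Steps R [] u u
  step : ∀ {c d p w} {u v z : Vec A n} → Swap c d p u v → R d c → Steps R w v z → Steps R (p ∷ w) u z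

private variable
  R S : A → A → Set
  u v : Vec A n
  w   : List ℕ

Steps-++ : ∀ {w'} {z : Vec A n} → Steps R w u v → Steps R w' v z → Steps R (w ++ w') u z
Steps-++ done         τ = τ
Steps-++ (step s r σ) τ = step s r (Steps-++ σ τ)

Steps-∷ : ∀ x → (∀ {d c} → R d c → S d c) → Steps R w u v → Steps S (List.map suc w) (x ∷ u) (x ∷ v)
Steps-∷ x f done         = done
Steps-∷ x f (step s r σ) = step (there s) (f r) (Steps-∷ x f σ)

Steps-map : ∀ (f : A → B) {S : B → B → Set} → (∀ {d c} → R d c → S (f d) (f c)) →
  Steps R w u v → Steps S w (Vec.map f u) (Vec.map f v)
Steps-map f g done         = done
Steps-map f g (step s r σ) = step (Swap-map f s) (g r) (Steps-map f g σ)

Steps-∈ : ∀ {a} → Steps R w u v → a ∈ u → a ∈ v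
Steps-∈ done         a∈ = a∈
Steps-∈ (step s r σ) a∈ = Steps-∈ σ (Swap-∈ s a∈)

Steps-∈⁻ : ∀ {a} → Steps R w u v → a ∈ v → a ∈ u
Steps-∈⁻ done         a∈ = a∈
Steps-∈⁻ (step s r σ) a∈ = Swap-∈ (Swap-sym s) (Steps-∈⁻ σ a∈)

Swap-unique : ∀ {c d : A} → Swap c d p u v → Unique u → Unique v
Swap-unique here ((c≢d VAll.∷ c∉) ∷ d∉ ∷ u!) = ((c≢d ∘ sym) VAll.∷ d∉) ∷ c∉ ∷ u!
Swap-unique {v = x ∷ v} (there s) (x∉ ∷ u!) =
  VAll.lookup⁻ (λ i → VAll.lookup x∉ (Swap-∈ (Swap-sym s) (∈-lookup i v))) ∷ Swap-unique s u!

Steps-unique : Steps R w u v → Unique u → Unique v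
Steps-unique done         u! = u!
Steps-unique (step s r σ) u! = Steps-unique σ (Swap-unique s u!)

-- Within the tail `y` is moved to the front by the shifted word; a last swap at position 0 carries
-- it past the head.
move-to-front : ∀ {y : A} {u : Vec A (suc n)} → Unique u → y ∈ u → (∀ {c} → c ∈ u → c ≢ y → R y c) →
  ∃ λ w → ∃ λ u' → length w ≤ n × Steps R w u (y ∷ u')
move-to-front {u = y ∷ u} _ (here refl) r = [] , u , z≤n , done
move-to-front {n = suc n} {R = R} {y} {x ∷ u} (x∉ ∷ u!) (there y∈) r
  with w , u' , len , σ ← move-to-front {R = R} u! y∈ (λ c∈ → r (there c∈)) =
  List.map suc w ++ 0 ∷ [] , x ∷ u' ,
  ≤-trans (≤-reflexive (trans (length-++ (List.map suc w)) (trans (+-comm _ 1) (cong suc (length-map suc w))))) (s≤s len) ,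
  Steps-++ (Steps-∷ x (λ r → r) σ) (step here (r (here refl) (VAll.lookup x∉ y∈)) done)

-- The head of `v` overtakes only entries that follow it in `v`, and sorting the tail does not touch
-- it. So every swap puts its pair into final order, which is what `climb` requires of a path.
selection-sort : ∀ (u v : Vec A n) → Unique u → Unique v → (∀ {a} → a ∈ u → a ∈ v) → (∀ {a} → a ∈ v → a ∈ u) →
  ∃ λ w → length w ≤ n * n × Steps (Before v) w u v
selection-sort []          []      _  _         _   _   = [] , z≤n , done
selection-sort {n = suc n} u@(_ ∷ _) (y ∷ v) u! (y∉ ∷ v!) u⊆v v⊆u =
  let w₁ , u' , len₁ , σ₁ = move-to-front u! (v⊆u (here refl)) overtaken
      yu'!                = Steps-unique σ₁ u!
      w₂ , len₂ , σ₂      = selection-sort u' v (AllPairs.tail yu'!) v!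
        (λ a∈ → ∈-tail (VAll.lookup (AllPairs.head yu'!) a∈ ∘ sym) (u⊆v (Steps-∈⁻ σ₁ (there a∈))))
        (λ a∈ → ∈-tail (VAll.lookup y∉ a∈ ∘ sym) (Steps-∈ σ₁ (v⊆u (there a∈))))
  in w₁ ++ List.map suc w₂ , bound w₁ w₂ len₁ len₂ , Steps-++ σ₁ (Steps-∷ y there σ₂)
  where
  ∈-tail : ∀ {a} {z : Vec _ n} → a ≢ y → a ∈ y ∷ z → a ∈ z
  ∈-tail a≢y (here a≡y) = contradiction a≡y a≢y
  ∈-tail a≢y (there a∈) = a∈

  overtaken : ∀ {c} → c ∈ u → c ≢ y → Before (y ∷ v) y c
  overtaken c∈ c≢y = here (∈-tail c≢y (u⊆v c∈))

  open ≤-Reasoning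
  bound : ∀ w₁ w₂ → length w₁ ≤ n → length w₂ ≤ n * n → length (w₁ ++ List.map suc w₂) ≤ suc n * suc n
  bound w₁ w₂ len₁ len₂ = begin
    length (w₁ ++ List.map suc w₂)  ≡⟨ trans (length-++ w₁) (cong (length w₁ +_) (length-map suc w₂)) ⟩
    length w₁ + length w₂           ≤⟨ +-mono-≤ len₁ len₂ ⟩
    n + n * n                       ≤⟨ +-mono-≤ (n≤1+n n) (*-monoʳ-≤ n (n≤1+n n)) ⟩
    suc n * suc n                   ∎

sorting-word : (r : Ranking k) → ∃ λ w → length w ≤ k * k × Steps (Before (proj₁ r)) w (Vec.allFin k) (proj₁ r)
sorting-word {k} r = selection-sort (Vec.allFin k) (proj₁ r)
  (surjective⇒unique _ ∈-allFin⁺) (ranking-unique r) (λ _ → ranking-∈ r _) (λ _ → ∈-allFin⁺ _)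

-- Swaps act on positions and so commute with renaming the entries. Renaming by `lookup (proj₁ r)`
-- turns the path from the identity to `s` into one from `r`, with the same word for every `r`.
⊚-Steps : ∀ (r s : Ranking k) → Steps (Before (proj₁ s)) w (Vec.allFin k) (proj₁ s) →
  Steps (Before (proj₁ (r ⊚ s))) w (proj₁ r) (proj₁ (r ⊚ s))
⊚-Steps r s σ = subst (λ u → Steps (Before (proj₁ (r ⊚ s))) _ u (proj₁ (r ⊚ s))) (map-lookup-allFin (proj₁ r))
  (Steps-map (lookup (proj₁ r)) (Before-map (lookup (proj₁ r))) σ)

-- If along a path towards z values change only from c to d as d overtakes c,
-- then the value only climbs in z.
climb : ∀ {c d a b e : A} {u v z : Vec A n} → Unique u → Unique z →
  Swap c d p u v → Before z d c →
  a ≡ b ⊎ (a ≡ c × b ≡ d) →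
  b ≡ e ⊎ (Before v b e × Before z e b) →
  a ≡ e ⊎ (Before u a e × Before z e a)
climb u! z! swap d>c (inj₁ refl)          (inj₁ refl) = inj₁ refl
climb u! z! swap d>c (inj₂ (refl , refl)) (inj₁ refl) = inj₂ (Swap⇒Before swap , d>c)
climb u! z! swap d>c (inj₁ refl)          (inj₂ (above , below)) with Before-Swap (Swap-sym swap) above
... | inj₁ (refl , refl) = contradiction below (Before-asym z! d>c)
... | inj₂ above'        = inj₂ (above' , below)
climb u! z! swap d>c (inj₂ (refl , refl)) (inj₂ (above , below)) with Before-Swap (Swap-sym swap) above
... | inj₁ (_ , refl) = contradiction below (Before-asym z! d>c)
... | inj₂ above'     = inj₂ (Before-trans u! (Swap⇒Before swap) above' , Before-trans z! below d>c)

-- Paths free of local manipulations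

module _ (h : Ranking k → Fin k) (μ : Ranking k → ℕ)
         (manip : ∀ r p → h (swapRanking p r) >[ r ] h r → 1 ≤ μ r) where

  -- Both ends of each edge are charged, since a swap may be a manipulation when read in either
  -- direction; this is the source of the factor 2 in 2k².
  cost : List ℕ → Ranking k → ℕ
  cost []      r = 0
  cost (p ∷ w) r = μ r + μ (swapRanking p r) + cost w (swapRanking p r)

  unmanipulated : ∀ {r} p → μ r ≡ 0 → ¬ Before (proj₁ r) (h (swapRanking p r)) (h r)
  unmanipulated p μ≡0 gain = <⇒≢ (manip _ p (Before⇒lookup gain)) (sym μ≡0)

  -- If the value changes, absence of a gain at `r` puts `h r` above `h s` in `r`, and absence of a
  -- gain at `s` puts `h s` above `h r` in `s`. The swap thus reverses this pair, and it reverses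
  -- only `c` and `d`.
  cost-free-edge : ∀ {c d p r s} → Swap c d p (proj₁ r) (proj₁ s) → μ r ≡ 0 → μ s ≡ 0 →
    h r ≡ h s ⊎ (h r ≡ c × h s ≡ d)
  cost-free-edge {p = p} {r} {s} swap μr≡0 μs≡0 with h r Fin.≟ h s
  ... | yes eq = inj₁ eq
  ... | no neq with Before-total (ranking-∈ r (h r)) (ranking-∈ r (h s)) neq
  ...   | inj₂ loses = contradiction (subst (λ t → Before (proj₁ r) (h t) (h r)) s≡ loses) (unmanipulated p μr≡0)
    where
    s≡ : s ≡ swapRanking p r
    s≡ = ranking-ext (sym (Swap⇒swapAt swap))
  ...   | inj₁ wins with Before-Swap swap wins
  ...     | inj₁ eqs = inj₂ eqs
  ...     | inj₂ gain = contradiction (subst (λ t → Before (proj₁ s) (h t) (h s)) r≡ gain) (unmanipulated p μs≡0)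
    where
    r≡ : r ≡ swapRanking p s
    r≡ = ranking-ext (sym (Swap⇒swapAt (Swap-sym swap)))

  cost-free : ∀ {r t} → Steps (Before (proj₁ t)) w (proj₁ r) (proj₁ t) → cost w r ≡ 0 →
    h r ≡ h t ⊎ (Before (proj₁ r) (h r) (h t) × Before (proj₁ t) (h t) (h r))
  -- The endpoint of the path becomes a variable `z` so that `Steps` can be matched on, while the
  -- order to be reached stays that of `t`.
  cost-free {w} {t = t} = go refl
    where
    go : ∀ {w r z} → z ≡ proj₁ t → Steps (Before (proj₁ t)) w (proj₁ r) z → cost w r ≡ 0 →
      h r ≡ h t ⊎ (Before (proj₁ r) (h r) (h t) × Before (proj₁ t) (h t) (h r))
    go eq done _ = inj₁ (cong h (ranking-ext eq))
    go {p ∷ w} {r} eq (step swap d>c σ) cost≡0 with refl ← Swap⇒swapAt swap =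
      climb (ranking-unique r) (ranking-unique t) swap d>c
        (cost-free-edge {s = s} swap (m+n≡0⇒m≡0 (μ r) μ≡0) (m+n≡0⇒n≡0 (μ r) μ≡0))
        (go {r = s} eq σ (m+n≡0⇒n≡0 (μ r + μ s) cost≡0))
      where
      s : Ranking k
      s = swapRanking p r
      μ≡0 : μ r + μ s ≡ 0
      μ≡0 = m+n≡0⇒m≡0 _ cost≡0

-- Local manipulations and gains from a random change

module _ (xs : List A) where

  ∑-allVecsOf-suc : ∀ (φ : Vec A (suc n) → ℕ) →
    ∑ (allVecsOf xs (suc n)) φ ≡ (∑[ x ∈ xs ] ∑[ v ∈ allVecsOf xs n ] φ (x ∷ v))
  ∑-allVecsOf-suc φ = trans (∑-concatMap xs _ φ) (∑-cong xs λ x → ∑-map (allVecsOf xs _) (x ∷_) φ)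

  ∑-resample : ∀ (i : Fin n) (φ : Vec A n → ℕ) →
    (∑[ v ∈ allVecsOf xs n ] ∑[ x ∈ xs ] φ (v [ i ]≔ x)) ≡ length xs * ∑ (allVecsOf xs n) φ
  ∑-resample {suc n} zero φ = begin
    (∑[ v ∈ allVecsOf xs (suc n) ] ∑[ x ∈ xs ] φ (v [ zero ]≔ x))    ≡⟨ ∑-allVecsOf-suc _ ⟩
    (∑[ _ ∈ xs ] ∑[ v ∈ allVecsOf xs n ] ∑[ x ∈ xs ] φ (x ∷ v))      ≡⟨ ∑-const xs _ ⟩
    length xs * (∑[ v ∈ allVecsOf xs n ] ∑[ x ∈ xs ] φ (x ∷ v))      ≡⟨ cong (length xs *_) (∑-swap (allVecsOf xs n) xs _) ⟩
    length xs * (∑[ x ∈ xs ] ∑[ v ∈ allVecsOf xs n ] φ (x ∷ v))      ≡⟨ cong (length xs *_) (∑-allVecsOf-suc φ) ⟨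
    length xs * ∑ (allVecsOf xs (suc n)) φ                           ∎
    where open ≡-Reasoning
  ∑-resample {suc n} (suc i) φ = begin
    (∑[ v ∈ allVecsOf xs (suc n) ] ∑[ x ∈ xs ] φ (v [ suc i ]≔ x))          ≡⟨ ∑-allVecsOf-suc _ ⟩
    (∑[ y ∈ xs ] ∑[ v ∈ allVecsOf xs n ] ∑[ x ∈ xs ] φ (y ∷ (v [ i ]≔ x)))  ≡⟨ ∑-cong xs (λ y → ∑-resample i (φ ∘ (y ∷_))) ⟩
    (∑[ y ∈ xs ] length xs * (∑[ v ∈ allVecsOf xs n ] φ (y ∷ v)))           ≡⟨ ∑-*ˡ xs (length xs) _ ⟩
    length xs * (∑[ y ∈ xs ] ∑[ v ∈ allVecsOf xs n ] φ (y ∷ v))             ≡⟨ cong (length xs *_) (∑-allVecsOf-suc φ) ⟨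
    length xs * ∑ (allVecsOf xs (suc n)) φ                                  ∎
    where open ≡-Reasoning

  -- The two vectors agree off `i`, and their entries at `i` are independent and uniform, so they
  -- form an exchangeable pair.
  ∑-exchange : ∀ (i : Fin n) (φ : Vec A n → Vec A n → ℕ) →
    (∑[ v ∈ allVecsOf xs n ] ∑[ x ∈ xs ] φ v (v [ i ]≔ x)) ≡ (∑[ v ∈ allVecsOf xs n ] ∑[ x ∈ xs ] φ (v [ i ]≔ x) v)
  ∑-exchange {suc n} zero φ = begin
    (∑[ v ∈ allVecsOf xs (suc n) ] ∑[ x ∈ xs ] φ v (v [ zero ]≔ x))         ≡⟨ ∑-allVecsOf-suc _ ⟩
    (∑[ y ∈ xs ] ∑[ v ∈ allVecsOf xs n ] ∑[ x ∈ xs ] φ (y ∷ v) (x ∷ v))     ≡⟨ ∑-cong xs (λ y → ∑-swap (allVecsOf xs n) xs _) ⟩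
    (∑[ y ∈ xs ] ∑[ x ∈ xs ] ∑[ v ∈ allVecsOf xs n ] φ (y ∷ v) (x ∷ v))     ≡⟨ ∑-swap xs xs _ ⟩
    (∑[ x ∈ xs ] ∑[ y ∈ xs ] ∑[ v ∈ allVecsOf xs n ] φ (y ∷ v) (x ∷ v))     ≡⟨ ∑-cong xs (λ x → ∑-swap xs (allVecsOf xs n) _) ⟩
    (∑[ x ∈ xs ] ∑[ v ∈ allVecsOf xs n ] ∑[ y ∈ xs ] φ (y ∷ v) (x ∷ v))     ≡⟨ ∑-allVecsOf-suc _ ⟨
    (∑[ v ∈ allVecsOf xs (suc n) ] ∑[ x ∈ xs ] φ (v [ zero ]≔ x) v)         ∎
    where open ≡-Reasoning
  ∑-exchange {suc n} (suc i) φ = begin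
    (∑[ v ∈ allVecsOf xs (suc n) ] ∑[ x ∈ xs ] φ v (v [ suc i ]≔ x))                  ≡⟨ ∑-allVecsOf-suc _ ⟩
    (∑[ y ∈ xs ] ∑[ v ∈ allVecsOf xs n ] ∑[ x ∈ xs ] φ (y ∷ v) (y ∷ (v [ i ]≔ x)))    ≡⟨ ∑-cong xs (λ y → ∑-exchange i (λ v w → φ (y ∷ v) (y ∷ w))) ⟩
    (∑[ y ∈ xs ] ∑[ v ∈ allVecsOf xs n ] ∑[ x ∈ xs ] φ (y ∷ (v [ i ]≔ x)) (y ∷ v))    ≡⟨ ∑-allVecsOf-suc _ ⟨
    (∑[ v ∈ allVecsOf xs (suc n) ] ∑[ x ∈ xs ] φ (v [ suc i ]≔ x) v)                  ∎
    where open ≡-Reasoning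

  ∑-transform : ∀ {s : A → A} → (∀ φ → ∑ xs (φ ∘ s) ≡ ∑ xs φ) → ∀ (i : Fin n) (φ : Vec A n → ℕ) →
    (∑[ v ∈ allVecsOf xs n ] φ (v [ i ]≔ s (lookup v i))) ≡ ∑ (allVecsOf xs n) φ
  ∑-transform {suc n} {s} inv zero φ = begin
    (∑[ v ∈ allVecsOf xs (suc n) ] φ (v [ zero ]≔ s (lookup v zero)))  ≡⟨ ∑-allVecsOf-suc _ ⟩
    (∑[ x ∈ xs ] ∑[ v ∈ allVecsOf xs n ] φ (s x ∷ v))                  ≡⟨ inv _ ⟩
    (∑[ x ∈ xs ] ∑[ v ∈ allVecsOf xs n ] φ (x ∷ v))                    ≡⟨ ∑-allVecsOf-suc φ ⟨
    ∑ (allVecsOf xs (suc n)) φ                                         ∎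
    where open ≡-Reasoning
  ∑-transform {suc n} {s} inv (suc i) φ = begin
    (∑[ v ∈ allVecsOf xs (suc n) ] φ (v [ suc i ]≔ s (lookup v (suc i))))   ≡⟨ ∑-allVecsOf-suc _ ⟩
    (∑[ y ∈ xs ] ∑[ v ∈ allVecsOf xs n ] φ (y ∷ (v [ i ]≔ s (lookup v i)))) ≡⟨ ∑-cong xs (λ y → ∑-transform inv i (φ ∘ (y ∷_))) ⟩
    (∑[ y ∈ xs ] ∑[ v ∈ allVecsOf xs n ] φ (y ∷ v))                         ≡⟨ ∑-allVecsOf-suc φ ⟨
    ∑ (allVecsOf xs (suc n)) φ                                              ∎
    where open ≡-Reasoning

  ∑-marginal : ∀ (i : Fin n) (ψ : A → ℕ) →
    length xs * (∑[ v ∈ allVecsOf xs n ] ψ (lookup v i)) ≡ length (allVecsOf xs n) * ∑ xs ψ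
  ∑-marginal {n} i ψ = begin
    length xs * (∑[ v ∈ allVecsOf xs n ] ψ (lookup v i))               ≡⟨ ∑-resample i (λ v → ψ (lookup v i)) ⟨
    (∑[ v ∈ allVecsOf xs n ] ∑[ x ∈ xs ] ψ (lookup (v [ i ]≔ x) i))    ≡⟨ ∑-cong (allVecsOf xs n) (λ v → ∑-cong xs λ x → cong ψ (lookup∘update i v x)) ⟩
    (∑[ v ∈ allVecsOf xs n ] ∑[ x ∈ xs ] ψ x)                          ≡⟨ ∑-const (allVecsOf xs n) _ ⟩
    length (allVecsOf xs n) * ∑ xs ψ                                   ∎
    where open ≡-Reasoning

∑ᴿ-involution : ∀ (s : Ranking k → Ranking k) → (∀ r → s (s r) ≡ r) →
  ∀ φ → ∑ (allRankings k) (φ ∘ s) ≡ ∑ (allRankings k) φ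
∑ᴿ-involution {k} = ∑-involution {xs = allRankings k} (allRankings-unique k) (allRankings-complete {k})

∑ᴿ-surjective : ∀ (s : Ranking k → Ranking k) → (∀ t → ∃ λ r → s r ≡ t) →
  ∀ φ → ∑ (allRankings k) φ ≤ ∑ (allRankings k) (φ ∘ s)
∑ᴿ-surjective {k} = ∑-surjective {xs = allRankings k} (allRankings-unique k) (allRankings-complete {k})

gain : SCF n k → Fin n → Profile n k → Ranking k → ℕ
gain f i σ τ = 𝟙 (above? (proj₁ (lookup σ i)) (f (σ [ i ]≔ τ)) (f σ))

gains : SCF n k → Fin n → ℕ
gains {n} {k} f i = ∑[ σ ∈ allProfiles n k ] ∑[ τ ∈ allRankings k ] gain f i σ τ

disagreements : SCF n k → SCF n k → ℕ
disagreements {n} {k} f g = ∑[ σ ∈ allProfiles n k ] 𝟙 (¬? (f σ Fin.≟ g σ))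

local-manipulations : SCF n k → ℕ
local-manipulations {n} {k} f = ∑[ σ ∈ allProfiles n k ] 𝟙 (manipR? 3 f σ)

local-manipulation : ∀ (f : SCF n k) i σ p →
  f (σ [ i ]≔ swapRanking p (lookup σ i)) >[ lookup σ i ] f σ → ManipR 3 f σ
local-manipulation {k = zero}  f i σ p better = contradiction (f σ) λ ()
local-manipulation {k = suc k} f i σ p better = i , ListAny.map
  (λ { refl → swapRanking-AdjPerm p (lookup σ i) , better }) (allRankings-complete (swapRanking p (lookup σ i)))

module _ (f : SCF n k) (i : Fin n) (M : Profile n k → ℕ)
         (manip : ∀ σ p → f (σ [ i ]≔ swapRanking p (lookup σ i)) >[ lookup σ i ] f σ → 1 ≤ M σ) where

  private
    Ps : List (Profile n k)
    Ps = allProfiles n k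

    Rs : List (Ranking k)
    Rs = allRankings k

    at : Profile n k → Ranking k → Fin k
    at σ ρ = f (σ [ i ]≔ ρ)

    μ : Profile n k → Ranking k → ℕ
    μ σ ρ = M (σ [ i ]≔ ρ)

  μ-manip : ∀ σ ρ p → at σ (swapRanking p ρ) >[ ρ ] at σ ρ → 1 ≤ μ σ ρ
  μ-manip σ ρ p better = manip (σ [ i ]≔ ρ) p (subst₂
    (λ σ' τ → f σ' >[ τ ] f (σ [ i ]≔ ρ))
    (trans (sym ([]≔-idempotent σ i)) (cong (λ τ → (σ [ i ]≔ ρ) [ i ]≔ swapRanking p τ) (sym (lookup∘update i σ ρ))))
    (sym (lookup∘update i σ ρ)) better)

  path-cost : List ℕ → Profile n k → Ranking k → ℕ
  path-cost w σ = cost (at σ) (μ σ) (μ-manip σ) w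

  -- The map `t` is the composite of the swaps made so far. It preserves sums because the word does
  -- not depend on the profile, so every vertex of the path is as likely as a uniform profile to be
  -- charged. The induction extends `t` by one swap.
  ∑-path-cost : ∀ w {t : Ranking k → Ranking k} → (∀ φ → ∑ Rs (φ ∘ t) ≡ ∑ Rs φ) →
    (∑[ σ ∈ Ps ] path-cost w σ (t (lookup σ i))) ≡ length w * (∑ Ps M + ∑ Ps M)
  ∑-path-cost [] inv = trans (∑-const Ps 0) (*-zeroʳ (length Ps))
  ∑-path-cost (p ∷ w) {t} inv = begin
    (∑[ σ ∈ Ps ] (μ σ (t (lookup σ i)) + μ σ (t' (lookup σ i)) + path-cost w σ (t' (lookup σ i))))
      ≡⟨ trans (∑-+ Ps _ _) (cong (_+ (∑[ σ ∈ Ps ] path-cost w σ (t' (lookup σ i)))) (∑-+ Ps _ _)) ⟩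
    (∑[ σ ∈ Ps ] μ σ (t (lookup σ i))) + (∑[ σ ∈ Ps ] μ σ (t' (lookup σ i))) + (∑[ σ ∈ Ps ] path-cost w σ (t' (lookup σ i)))
      ≡⟨ cong₂ _+_ (cong₂ _+_ (∑-transform Rs inv i M) (∑-transform Rs inv' i M)) (∑-path-cost w inv') ⟩
    ∑ Ps M + ∑ Ps M + length w * (∑ Ps M + ∑ Ps M)
      ∎
    where
    open ≡-Reasoning
    t' : Ranking k → Ranking k
    t' = swapRanking p ∘ t
    inv' : ∀ φ → ∑ Rs (φ ∘ t') ≡ ∑ Rs φ
    inv' φ = trans (inv (φ ∘ swapRanking p)) (∑ᴿ-involution (swapRanking p) (swapRanking-involutive p) φ)

  -- On a path of cost zero the outcome at the end is the old one or lies below it in the voter's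
  -- old ranking, so the voter has no gain.
  gain≤path-cost : ∀ σ ω → gain f i σ (lookup σ i ⊚ ω) ≤ path-cost (proj₁ (sorting-word ω)) σ (lookup σ i)
  gain≤path-cost σ ω = 𝟙≤ (above? (proj₁ (lookup σ i)) (at σ (lookup σ i ⊚ ω)) (f σ)) λ better → n≢0⇒n>0 λ free → impossible better
    (cost-free (at σ) (μ σ) (μ-manip σ) (⊚-Steps (lookup σ i) ω (proj₂ (proj₂ (sorting-word ω)))) free)
    where
    τ : Ranking k
    τ = lookup σ i ⊚ ω
    impossible : at σ τ >[ lookup σ i ] f σ →
      ¬ (at σ (lookup σ i) ≡ at σ τ ⊎ (Before (proj₁ (lookup σ i)) (at σ (lookup σ i)) (at σ τ) × Before (proj₁ τ) (at σ τ) (at σ (lookup σ i))))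
    impossible better result rewrite []≔-lookup σ i with result
    ... | inj₁ eq          = >-asym (lookup σ i) (subst (λ a → a >[ lookup σ i ] f σ) (sym eq) better) (subst (λ a → a >[ lookup σ i ] f σ) (sym eq) better)
    ... | inj₂ (above , _) = Before-asym (ranking-unique (lookup σ i)) above (Above⇒Before better)

  gains≤ : gains f i ≤ length Rs * (k * k * (∑ Ps M + ∑ Ps M))
  gains≤ = begin
    (∑[ σ ∈ Ps ] ∑[ τ ∈ Rs ] gain f i σ τ)                                ≤⟨ ∑-mono Ps (λ σ → ∑ᴿ-surjective (lookup σ i ⊚_) (⊚-surjective (lookup σ i)) _) ⟩
    (∑[ σ ∈ Ps ] ∑[ ω ∈ Rs ] gain f i σ (lookup σ i ⊚ ω))                 ≤⟨ ∑-mono Ps (λ σ → ∑-mono Rs (gain≤path-cost σ)) ⟩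
    (∑[ σ ∈ Ps ] ∑[ ω ∈ Rs ] path-cost (proj₁ (sorting-word ω)) σ (lookup σ i))  ≡⟨ ∑-swap Ps Rs _ ⟩
    (∑[ ω ∈ Rs ] ∑[ σ ∈ Ps ] path-cost (proj₁ (sorting-word ω)) σ (lookup σ i))  ≡⟨ ∑-cong Rs (λ ω → ∑-path-cost (proj₁ (sorting-word ω)) (λ φ → refl)) ⟩
    (∑[ ω ∈ Rs ] length (proj₁ (sorting-word ω)) * (∑ Ps M + ∑ Ps M))               ≤⟨ ∑-bounded Rs (λ ω → *-monoˡ-≤ (∑ Ps M + ∑ Ps M) (proj₁ (proj₂ (sorting-word ω)))) ⟩
    length Rs * (k * k * (∑ Ps M + ∑ Ps M))                                 ∎
    where
    open ≤-Reasoning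

-- A gain refers to the function at `σ` and at the resampled profile. Each of the two is uniform, so
-- a disagreement is paid for once at each.
gains-transfer : ∀ (f g : SCF n k) i →
  gains g i ≤ gains f i + length (allRankings k) * (disagreements f g + disagreements f g)
gains-transfer {n} {k} f g i = begin
  gains g i
    ≤⟨ ∑-mono Ps (λ σ → ∑-mono Rs (pointwise σ)) ⟩
  (∑[ σ ∈ Ps ] ∑[ τ ∈ Rs ] (gain f i σ τ + (δ σ + δ (σ [ i ]≔ τ))))
    ≡⟨ ∑-cong Ps (λ σ → trans (∑-+ Rs _ _) (cong (∑ Rs (gain f i σ) +_) (trans (∑-+ Rs _ _) (cong (_+ (∑[ τ ∈ Rs ] δ (σ [ i ]≔ τ))) (∑-const Rs (δ σ)))))) ⟩
  (∑[ σ ∈ Ps ] (∑ Rs (gain f i σ) + (length Rs * δ σ + ∑ Rs (λ τ → δ (σ [ i ]≔ τ)))))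
    ≡⟨ trans (∑-+ Ps _ _) (cong (gains f i +_) (trans (∑-+ Ps _ _) (cong₂ _+_ (∑-*ˡ Ps (length Rs) δ) (∑-resample Rs i δ)))) ⟩
  gains f i + (length Rs * disagreements f g + length Rs * disagreements f g)
    ≡⟨ cong (gains f i +_) (*-distribˡ-+ (length Rs) (disagreements f g) (disagreements f g)) ⟨
  gains f i + length Rs * (disagreements f g + disagreements f g)
    ∎
  where
  open ≤-Reasoning
  Ps : List (Profile n k)
  Ps = allProfiles n k
  Rs : List (Ranking k)
  Rs = allRankings k
  δ : Profile n k → ℕ
  δ σ = 𝟙 (¬? (f σ Fin.≟ g σ))
  pointwise : ∀ σ τ → gain g i σ τ ≤ gain f i σ τ + (δ σ + δ (σ [ i ]≔ τ))
  pointwise σ τ with f σ Fin.≟ g σ | f (σ [ i ]≔ τ) Fin.≟ g (σ [ i ]≔ τ)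
  ... | yes eq | yes eq' rewrite eq | eq' = m≤m+n _ _
  ... | no _   | _       = ≤-trans (𝟙≤1 (above? (proj₁ (lookup σ i)) (g (σ [ i ]≔ τ)) (g σ))) (≤-trans (s≤s z≤n) (m≤n+m _ (gain f i σ τ)))
  ... | yes _  | no _    = ≤-trans (𝟙≤1 (above? (proj₁ (lookup σ i)) (g (σ [ i ]≔ τ)) (g σ))) (m≤n+m 1 (gain f i σ τ))

-- Functions of one coordinate

topL-best : ∀ (H : Subset k) (v : Vec (Fin k) n) {a} → a Subset.∈ H → a ∈ v →
  ∃ λ c → just c ≡ topL H (Vec.toList v) × c Subset.∈ H × (∀ {b} → b Subset.∈ H → b ∈ v → b ≡ c ⊎ Before v c b)
topL-best H (x ∷ v) a∈H a∈ with x ∈? H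
... | yes x∈H = x , refl , x∈H , λ { _ (here b≡x) → inj₁ b≡x ; _ (there b∈) → inj₂ (here b∈) }
topL-best H (x ∷ v) a∈H (here refl) | no x∉H = contradiction a∈H x∉H
topL-best H (x ∷ v) a∈H (there a∈)  | no x∉H with topL-best H v a∈H a∈
... | c , eq , c∈H , best = c , eq , c∈H , λ where
  b∈H (here refl) → contradiction b∈H x∉H
  b∈H (there b∈)  → Data.Sum.map₂ there (best b∈H b∈)

top-best : ∀ {H : Subset k} → Nonempty H → (r : Ranking k) →
  ∃ λ c → just c ≡ top H r × c Subset.∈ H × (∀ {b} → b Subset.∈ H → b ≡ c ⊎ Before (proj₁ r) c b)
top-best {H = H} (a , a∈H) r with topL-best H (proj₁ r) a∈H (ranking-∈ r a)
... | c , eq , c∈H , best = c , eq , c∈H , λ b∈H → best b∈H (ranking-∈ r _)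

dictator : Fin n → ∀ {H : Subset k} → Nonempty H → SCF n k
dictator i ne σ = proj₁ (top-best ne (lookup σ i))

dictator-top : ∀ (i : Fin n) {H : Subset k} (ne : Nonempty H) σ → just (dictator i ne σ) ≡ top H (lookup σ i)
dictator-top i ne σ = proj₁ (proj₂ (top-best ne (lookup σ i)))

dictator-NONMANIP : ∀ (i : Fin n) {H : Subset k} (ne : Nonempty H) → NONMANIP (dictator i ne)
dictator-NONMANIP i {H} ne = inj₁ (i , H , ne , dictator-top i ne)

dictator-∈ : ∀ (i : Fin n) {H : Subset k} (ne : Nonempty H) σ → dictator i ne σ Subset.∈ H
dictator-∈ i ne σ = proj₁ (proj₂ (proj₂ (top-best ne (lookup σ i))))

dictator-best : ∀ (i : Fin n) {H : Subset k} (ne : Nonempty H) σ {b} → b Subset.∈ H →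
  b ≡ dictator i ne σ ⊎ dictator i ne σ >[ lookup σ i ] b
dictator-best i ne σ b∈H = Data.Sum.map₂ Before⇒lookup (proj₂ (proj₂ (proj₂ (top-best ne (lookup σ i)))) b∈H)

module _ (g : SCF n k) (i : Fin n) (dep : ∀ σ σ' → lookup σ i ≡ lookup σ' i → g σ ≡ g σ') where

  private
    Ps : List (Profile n k)
    Ps = allProfiles n k

    Rs : List (Ranking k)
    Rs = allRankings k

  value? : ∀ b σ → Dec (g σ ≡ b)
  value? b σ = g σ Fin.≟ b

  better? : ∀ b σ → Dec (b >[ lookup σ i ] g σ)
  better? b σ = above? (proj₁ (lookup σ i)) b (g σ)

  frequency regret : Fin k → ℕ
  frequency b = ∑[ σ ∈ Ps ] 𝟙 (value? b σ)
  regret    b = ∑[ σ ∈ Ps ] 𝟙 (better? b σ)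

  -- A voter with regret for b obtains b by adopting an independent ranking that yields b.
  frequency*regret≤ : ∀ b → length Rs * (regret b * frequency b) ≤ length Ps * gains g i
  frequency*regret≤ b = begin
    length Rs * (regret b * frequency b)
      ≡⟨ cong (length Rs *_) (∑-*ʳ Ps (frequency b) (λ σ → 𝟙 (better? b σ))) ⟨
    length Rs * (∑[ σ ∈ Ps ] 𝟙 (better? b σ) * frequency b)
      ≡⟨ cong (length Rs *_) (∑-cong Ps λ σ → ∑-*ˡ Ps (𝟙 (better? b σ)) (λ σ' → 𝟙 (value? b σ'))) ⟨
    length Rs * (∑[ σ ∈ Ps ] ∑[ σ' ∈ Ps ] 𝟙 (better? b σ) * 𝟙 (value? b σ'))
      ≤⟨ *-monoʳ-≤ (length Rs) (∑-mono Ps λ σ → ∑-mono Ps (pointwise σ)) ⟩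
    length Rs * (∑[ σ ∈ Ps ] ∑[ σ' ∈ Ps ] gain g i σ (lookup σ' i))
      ≡⟨ ∑-*ˡ Ps (length Rs) (λ σ → ∑[ σ' ∈ Ps ] gain g i σ (lookup σ' i)) ⟨
    (∑[ σ ∈ Ps ] length Rs * (∑[ σ' ∈ Ps ] gain g i σ (lookup σ' i)))
      ≡⟨ ∑-cong Ps (λ σ → ∑-marginal Rs i (gain g i σ)) ⟩
    (∑[ σ ∈ Ps ] length Ps * (∑[ τ ∈ Rs ] gain g i σ τ))
      ≡⟨ ∑-*ˡ Ps (length Ps) (λ σ → ∑[ τ ∈ Rs ] gain g i σ τ) ⟩
    length Ps * gains g i
      ∎
    where
    open ≤-Reasoning
    pointwise : ∀ σ σ' → 𝟙 (better? b σ) * 𝟙 (value? b σ') ≤ gain g i σ (lookup σ' i)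
    pointwise σ σ' with g σ' Fin.≟ b
    ... | no _     = ≤-trans (≤-reflexive (*-zeroʳ (𝟙 (better? b σ)))) z≤n
    ... | yes refl = ≤-trans (≤-reflexive (*-identityʳ (𝟙 (better? b σ))))
      (𝟙-mono (better? b σ) (above? (proj₁ (lookup σ i)) (g (σ [ i ]≔ lookup σ' i)) (g σ))
        (subst (λ c → c >[ lookup σ i ] g σ) (dep _ _ (sym (lookup∘update i σ (lookup σ' i))))))

  module _ {A K s : ℕ} (1≤K : 1 ≤ K) (0<L : 0 < length Rs)
           (gains≤ : gains g i ≤ length Rs * (K * A)) (NA≤s² : length Ps * A ≤ s * s) where

    regret≤ : ∀ b → s < frequency b → regret b ≤ K * s
    -- The factor cancelled is `suc s` rather than `s`, so that it is positive even if `s` is zero.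
    regret≤ b s<c = *-cancelʳ-≤ (regret b) (K * s) (suc s) (*-cancelˡ-≤ (length Rs) ⦃ ℕ.>-nonZero 0<L ⦄ (begin
      length Rs * (regret b * suc s)        ≤⟨ *-monoʳ-≤ (length Rs) (*-monoʳ-≤ (regret b) s<c) ⟩
      length Rs * (regret b * frequency b)  ≤⟨ frequency*regret≤ b ⟩
      length Ps * gains g i                 ≤⟨ *-monoʳ-≤ (length Ps) gains≤ ⟩
      length Ps * (length Rs * (K * A))     ≡⟨ x∙yz≈y∙xz *-commutativeSemigroup (length Ps) (length Rs) (K * A) ⟩
      length Rs * (length Ps * (K * A))     ≡⟨ cong (length Rs *_) (x∙yz≈y∙xz *-commutativeSemigroup (length Ps) K A) ⟩
      length Rs * (K * (length Ps * A))     ≤⟨ *-monoʳ-≤ (length Rs) (*-monoʳ-≤ K NA≤s²) ⟩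
      length Rs * (K * (s * s))             ≡⟨ cong (length Rs *_) (*-assoc K s s) ⟨
      length Rs * (K * s * s)               ≤⟨ *-monoʳ-≤ (length Rs) (*-monoʳ-≤ (K * s) (n≤1+n s)) ⟩
      length Rs * (K * s * suc s)           ∎))
      where
      open ≤-Reasoning

    frequent : Subset k
    frequent = Vec.tabulate λ b → does (s <? frequency b)

    ∈-frequent : ∀ {b} → s < frequency b → b Subset.∈ frequent
    ∈-frequent {b} lt = lookup⇒[]= b frequent (trans (lookup∘tabulate _ b) (dec-true (s <? frequency b) lt))

    frequent-∈ : ∀ {b} → b Subset.∈ frequent → s < frequency b
    frequent-∈ {b} b∈ = does⇒ (s <? frequency b)
      (trans (sym (lookup∘tabulate (λ b → does (s <? frequency b)) b)) ([]=⇒lookup b∈))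
      where
      does⇒ : ∀ {P : Set} (d : Dec P) → does d ≡ true → P
      does⇒ (yes p) _ = p

    -- The contribution of `b` to the disagreement with top_H: for `b` in H the voter prefers `b` to
    -- the outcome, for `b` outside H the outcome is `b` itself. The decision is an argument so that
    -- it can be matched on.
    defectBy : ∀ b → Dec (s < frequency b) → Profile n k → ℕ
    defectBy b (yes _) σ = 𝟙 (better? b σ)
    defectBy b (no _)  σ = 𝟙 (value? b σ)

    defect : Fin k → Profile n k → ℕ
    defect b = defectBy b (s <? frequency b)

    defect-frequent : ∀ b σ (d : Dec (s < frequency b)) → s < frequency b → b >[ lookup σ i ] g σ → defectBy b d σ ≡ 1
    defect-frequent b σ (yes _) _  better = 𝟙-yes (better? b σ) better
    defect-frequent b σ (no ≮)  lt _      = contradiction lt ≮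

    defect-rare : ∀ b σ (d : Dec (s < frequency b)) → ¬ s < frequency b → g σ ≡ b → defectBy b d σ ≡ 1
    defect-rare b σ (yes lt) ≮ _  = contradiction lt ≮
    defect-rare b σ (no _)   _ eq = 𝟙-yes (value? b σ) eq

    ∑-defect≤ : ∀ b (d : Dec (s < frequency b)) → (∑[ σ ∈ Ps ] defectBy b d σ) ≤ K * s
    ∑-defect≤ b (yes lt) = regret≤ b lt
    ∑-defect≤ b (no  ≮)  = ≤-trans (≮⇒≥ ≮) (m≤n*m s K ⦃ ℕ.>-nonZero 1≤K ⦄)

    -- Where `g` differs from top_H, either its value is rare, or its value is in H and the voter
    -- prefers the top of H to it. Either way some alternative has a defect, and a union bound over
    -- the `k` alternatives finishes.
    near-dictator : Fin k → ∃ λ g' → NONMANIP g' × disagreements g g' ≤ k * (K * s)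
    near-dictator a₀ = Data.Product.map₂ (Data.Product.map₂ bound) choice
      where
      some-defect : ∀ b σ {c} → defect b σ ≡ 1 → c ≤ 1 → c ≤ (∑[ b ∈ List.allFin k ] defect b σ)
      some-defect b σ eq c≤1 = ≤-trans c≤1 (≤-trans (≤-reflexive (sym eq))
        (∈⇒≤∑ (λ b → defect b σ) (List.∈-allFin b)))

      choice : ∃ λ g' → NONMANIP g' × (∀ σ → 𝟙 (¬? (g σ Fin.≟ g' σ)) ≤ (∑[ b ∈ List.allFin k ] defect b σ))
      choice with nonempty? frequent
      ... | yes ne = dictator i ne , dictator-NONMANIP i ne , pointwise
        where
        pointwise : ∀ σ → 𝟙 (¬? (g σ Fin.≟ dictator i ne σ)) ≤ (∑[ b ∈ List.allFin k ] defect b σ)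
        pointwise σ = 𝟙≤ (¬? (g σ Fin.≟ dictator i ne σ)) λ g≢ → case-frequent g≢ (s <? frequency (g σ))
          where
          case-frequent : g σ ≢ dictator i ne σ → Dec (s < frequency (g σ)) → 1 ≤ (∑[ b ∈ List.allFin k ] defect b σ)
          case-frequent g≢ (no ≮)   = some-defect (g σ) σ (defect-rare (g σ) σ (s <? _) ≮ refl) ≤-refl
          case-frequent g≢ (yes lt) with dictator-best i ne σ (∈-frequent lt)
          ... | inj₁ eq     = contradiction eq g≢
          ... | inj₂ better = some-defect c σ (defect-frequent c σ (s <? frequency c) (frequent-∈ (dictator-∈ i ne σ)) better) ≤-refl
            where
            c : Fin k
            c = dictator i ne σ
      -- If no value is frequent, every profile has a defect at its own value, so the bound covers
      -- all profiles and any dictator will do.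
      ... | no empty = dictator i (a₀ , x∈⁅x⁆ a₀) , dictator-NONMANIP i (a₀ , x∈⁅x⁆ a₀) ,
        λ σ → some-defect (g σ) σ (defect-rare (g σ) σ (s <? _) (λ lt → empty (_ , ∈-frequent lt)) refl) (𝟙≤1 (¬? (g σ Fin.≟ dictator i (a₀ , x∈⁅x⁆ a₀) σ)))

      open ≤-Reasoning
      bound : ∀ {g'} → (∀ σ → 𝟙 (¬? (g σ Fin.≟ g' σ)) ≤ (∑[ b ∈ List.allFin k ] defect b σ)) →
        disagreements g g' ≤ k * (K * s)
      bound {g'} pointwise = begin
        disagreements g g'                                        ≤⟨ ∑-mono Ps pointwise ⟩
        (∑[ σ ∈ Ps ] ∑[ b ∈ List.allFin k ] defect b σ)     ≡⟨ ∑-swap Ps (List.allFin k) (λ σ b → defect b σ) ⟩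
        (∑[ b ∈ List.allFin k ] ∑[ σ ∈ Ps ] defect b σ)     ≤⟨ ∑-bounded (List.allFin k) (λ b → ∑-defect≤ b (s <? frequency b)) ⟩
        length (List.allFin k) * (K * s)                    ≡⟨ cong (_* (K * s)) (length-tabulate {n = k} (λ b → b)) ⟩
        k * (K * s)                                           ∎

-- Functions with two values

∑-some-≤ : ∀ (xs : List A) {φ : A → ℕ} {B} → 0 < length xs → ∑ xs φ ≤ length xs * B → ∃ λ x → φ x ≤ B
∑-some-≤ (x ∷ xs) _ = go x xs
  where
  go : ∀ x xs {φ B} → ∑ (x ∷ xs) φ ≤ length (x ∷ xs) * B → ∃ λ y → φ y ≤ B
  go x [] {φ} {B} le = x , +-cancelʳ-≤ 0 (φ x) B le
  go x (y ∷ ys) {φ} {B} le with φ x ≤? B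
  ... | yes φx≤B = x , φx≤B
  ... | no  φx≰B = go y ys (+-cancelˡ-≤ B _ _ (≤-trans (+-monoˡ-≤ (∑ (y ∷ ys) φ) (≰⇒≥ φx≰B)) le))

-- Sorting Boolean values

∀-Bool? : {P : Bool → Set} → (∀ p → Dec (P p)) → Dec (∀ p → P p)
∀-Bool? P? = map′ (λ { (t , f) true → t ; (t , f) false → f }) (λ h → h true , h false) (P? true ×-dec P? false)

fall : Bool → Bool → ℕ
fall true false = 1
fall _    _     = 0

-- With `true` standing for b and `false` for a, `x` and `y` are a voter's preferences before and
-- after a change and `p` and `q` the outcomes. An outcome falling from b to a is a violation unless
-- the preference falls likewise.
violation : Bool → Bool → Bool → Bool → ℕ
violation x y p q = (1 ∸ fall x y) * fall p q

differ : Bool → Bool → ℕ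
differ p q = fall p q + fall q p

differ-triangle : ∀ p q r → differ p r ≤ differ p q + differ q r
differ-triangle = from-yes (∀-Bool? λ p → ∀-Bool? λ q → ∀-Bool? λ r → differ p r ≤? differ p q + differ q r)

sorted : Bool → Bool → Bool → Bool
sorted x u w = if x then u ∨ w else u ∧ w

sorted-legal : ∀ x y u w → violation x y (sorted x u w) (sorted y u w) ≡ 0
sorted-legal = from-yes (∀-Bool? λ x → ∀-Bool? λ y → ∀-Bool? λ u → ∀-Bool? λ w →
  violation x y (sorted x u w) (sorted y u w) ℕ.≟ 0)

-- The maximum falls only if some argument falls, and if the minimum falls too, both do. Bounding
-- the two terms on the left separately would lose a factor 2 at each voter; bounding their sum
-- loses nothing.
sorted-violations : ∀ e x y u w u' w' →
  violation x y (sorted e u w) (sorted e u' w') + violation x y (sorted (not e) u w) (sorted (not e) u' w')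
    ≤ violation x y u u' + violation x y w w'
sorted-violations = from-yes (∀-Bool? λ e → ∀-Bool? λ x → ∀-Bool? λ y →
  ∀-Bool? λ u → ∀-Bool? λ w → ∀-Bool? λ u' → ∀-Bool? λ w' →
  violation x y (sorted e u w) (sorted e u' w') + violation x y (sorted (not e) u w) (sorted (not e) u' w')
    ≤? violation x y u u' + violation x y w w')

-- Here `p` is the outcome at a ranking of preference `e`, and `u`, `w` are the outcomes at two
-- samples of opposite preferences. If sorting changes `p`, then comparing `p` with one of the
-- samples already exhibits a violation.
sorted-differ : ∀ e x p u w → differ p (sorted e u w) ≤
  (violation e x p u + violation x e u p) + (violation e (not x) p w + violation (not x) e w p)
sorted-differ = from-yes (∀-Bool? λ e → ∀-Bool? λ x → ∀-Bool? λ p → ∀-Bool? λ u → ∀-Bool? λ w →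
  differ p (sorted e u w) ≤?
  (violation e x p u + violation x e u p) + (violation e (not x) p w + violation (not x) e w p))

module Sorting (xs : List A) (0<L : 0 < length xs)
               (s : A → A) (s-sum : ∀ φ → ∑ xs (φ ∘ s) ≡ ∑ xs φ)
               (x : A → Bool) (x-s : ∀ a → x (s a) ≡ not (x a)) where

  private
    L : ℕ
    L = length xs

    V : ∀ n → List (Vec A n)
    V n = allVecsOf xs n

  violationAt : Fin n → (Vec A n → Bool) → Vec A n → A → ℕ
  violationAt j γ v a = violation (x (lookup v j)) (x a) (γ v) (γ (v [ j ]≔ a))

  violations : Fin n → (Vec A n → Bool) → ℕ
  violations {n} j γ = ∑[ v ∈ V n ] ∑[ a ∈ xs ] violationAt j γ v a

  Legal : Fin n → (Vec A n → Bool) → Set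
  Legal j γ = ∀ v a → violationAt j γ v a ≡ 0

  distance : (Vec A n → Bool) → (Vec A n → Bool) → ℕ
  distance {n} γ δ = ∑[ v ∈ V n ] differ (γ v) (δ v)

  sortAt : Fin n → A → (Vec A n → Bool) → Vec A n → Bool
  sortAt i r γ v = sorted (x (lookup v i)) (γ (v [ i ]≔ r)) (γ (v [ i ]≔ s r))

  sortAt-update : ∀ (i : Fin n) r γ v a →
    sortAt i r γ (v [ i ]≔ a) ≡ sorted (x a) (γ (v [ i ]≔ r)) (γ (v [ i ]≔ s r))
  sortAt-update i r γ v a
    rewrite lookup∘update i v a | []≔-idempotent {x = a} {r} v i | []≔-idempotent {x = a} {s r} v i = refl

  sortAt-update′ : ∀ {i j : Fin n} → i ≢ j → ∀ r γ v a →
    sortAt i r γ (v [ j ]≔ a) ≡ sorted (x (lookup v i)) (γ ((v [ i ]≔ r) [ j ]≔ a)) (γ ((v [ i ]≔ s r) [ j ]≔ a))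
  sortAt-update′ {i = i} {j} i≢j r γ v a
    rewrite lookup∘update′ i≢j v a | []≔-commutes {x = r} {a} v i j i≢j | []≔-commutes {x = s r} {a} v i j i≢j = refl

  sortAt-legal : ∀ (i : Fin n) r γ → Legal i (sortAt i r γ)
  sortAt-legal i r γ v a rewrite sortAt-update i r γ v a =
    sorted-legal (x (lookup v i)) (x a) (γ (v [ i ]≔ r)) (γ (v [ i ]≔ s r))

  -- Pairing `v` with its image under `s` in coordinate `i` lets voter `i` show both preferences, as
  -- the sum in `sorted-violations` demands.
  sortAt-violationAt : ∀ {i j : Fin n} → i ≢ j → ∀ r γ v a →
    violationAt j (sortAt i r γ) v a + violationAt j (sortAt i r γ) (v [ i ]≔ s (lookup v i)) a
      ≤ violationAt j γ (v [ i ]≔ r) a + violationAt j γ (v [ i ]≔ s r) a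
  sortAt-violationAt {i = i} {j} i≢j r γ v a
    rewrite lookup∘update′ (i≢j ∘ sym) v (s (lookup v i))
          | lookup∘update′ (i≢j ∘ sym) v r
          | lookup∘update′ (i≢j ∘ sym) v (s r)
          | sortAt-update′ i≢j r γ v a
          | sortAt-update i r γ v (s (lookup v i))
          | sortAt-update′ i≢j r γ (v [ i ]≔ s (lookup v i)) a
          | lookup∘update i v (s (lookup v i))
          | []≔-idempotent {x = s (lookup v i)} {r} v i
          | []≔-idempotent {x = s (lookup v i)} {s r} v i
          | x-s (lookup v i)
    = sorted-violations (x (lookup v i)) (x (lookup v j)) (x a) _ _ _ _

  sortAt-preserves-legal : ∀ {i j : Fin n} r γ → Legal j γ → Legal j (sortAt i r γ)
  sortAt-preserves-legal {i = i} {j} r γ legal v a with i Fin.≟ j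
  ... | yes refl = sortAt-legal i r γ v a
  ... | no i≢j   = n≤0⇒n≡0 (≤-trans (m≤m+n _ _) (≤-trans (sortAt-violationAt i≢j r γ v a)
    (≤-reflexive (cong₂ _+_ (legal _ a) (legal _ a)))))

  ∑-sortAt-violations : ∀ (i j : Fin n) γ → (∑[ r ∈ xs ] violations j (sortAt i r γ)) ≤ L * violations j γ
  ∑-sortAt-violations {n} i j γ with i Fin.≟ j
  ... | yes refl = ≤-trans (≤-reflexive (trans (∑-cong xs λ r → trans (∑-cong (V n) λ v →
          trans (∑-cong xs (sortAt-legal i r γ v)) (trans (∑-const xs 0) (*-zeroʳ L)))
          (trans (∑-const (V n) 0) (*-zeroʳ (length (V n))))) (trans (∑-const xs 0) (*-zeroʳ L)))) z≤n
  ... | no i≢j = *-cancelˡ-≤ 2 (begin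
    -- The sum is doubled so that its second copy can be reindexed by applying `s` to coordinate
    -- `i`, which produces the pairs.
    2 * (∑[ r ∈ xs ] W r)
      ≡⟨ double (∑ xs W) ⟩
    (∑[ r ∈ xs ] W r) + (∑[ r ∈ xs ] W r)
      ≡⟨ cong (∑ xs W +_) (∑-cong xs λ r → ∑-transform xs s-sum i (λ v → ∑[ a ∈ xs ] violationAt j (sortAt i r γ) v a)) ⟨
    (∑[ r ∈ xs ] W r) + (∑[ r ∈ xs ] ∑[ v ∈ V n ] ∑[ a ∈ xs ] violationAt j (sortAt i r γ) (v [ i ]≔ s (lookup v i)) a)
      ≡⟨ ∑-+ xs _ _ ⟨
    (∑[ r ∈ xs ] (W r + (∑[ v ∈ V n ] ∑[ a ∈ xs ] violationAt j (sortAt i r γ) (v [ i ]≔ s (lookup v i)) a)))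
      ≤⟨ ∑-mono xs (λ r → ≤-trans (≤-reflexive (sym (∑-+ (V n) _ _))) (∑-mono (V n) λ v →
           ≤-trans (≤-reflexive (sym (∑-+ xs _ _))) (≤-trans (∑-mono xs (sortAt-violationAt i≢j r γ v)) (≤-reflexive (∑-+ xs _ _))))) ⟩
    (∑[ r ∈ xs ] ∑[ v ∈ V n ] (Q (v [ i ]≔ r) + Q (v [ i ]≔ s r)))
      ≡⟨ ∑-swap xs (V n) _ ⟩
    (∑[ v ∈ V n ] ∑[ r ∈ xs ] (Q (v [ i ]≔ r) + Q (v [ i ]≔ s r)))
      ≡⟨ ∑-cong (V n) (λ v → trans (∑-+ xs _ _) (trans (cong ((∑[ r ∈ xs ] Q (v [ i ]≔ r)) +_) (s-sum (λ r → Q (v [ i ]≔ r)))) (sym (double (∑[ r ∈ xs ] Q (v [ i ]≔ r)))))) ⟩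
    (∑[ v ∈ V n ] 2 * (∑[ r ∈ xs ] Q (v [ i ]≔ r)))
      ≡⟨ ∑-*ˡ (V n) 2 _ ⟩
    2 * (∑[ v ∈ V n ] ∑[ r ∈ xs ] Q (v [ i ]≔ r))
      ≡⟨ cong (2 *_) (∑-resample xs i Q) ⟩
    2 * (L * violations j γ)
      ∎)
    where
    open ≤-Reasoning
    double : ∀ m → 2 * m ≡ m + m
    double m = cong (m +_) (+-identityʳ m)
    W : A → ℕ
    W r = violations j (sortAt i r γ)
    Q : Vec A n → ℕ
    Q v = ∑[ a ∈ xs ] violationAt j γ v a

  -- The 4 counts two samples, `r` and `s r`, each compared with `v` in both directions.
  ∑-sortAt-distance : ∀ (i : Fin n) γ → (∑[ r ∈ xs ] distance γ (sortAt i r γ)) ≤ 4 * violations i γ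
  ∑-sortAt-distance {n} i γ = begin
    (∑[ r ∈ xs ] ∑[ v ∈ V n ] differ (γ v) (sortAt i r γ v))
      ≤⟨ ∑-mono xs (λ r → ∑-mono (V n) (pointwise r)) ⟩
    (∑[ r ∈ xs ] ∑[ v ∈ V n ] (Both v r + Both v (s r)))
      ≡⟨ ∑-swap xs (V n) _ ⟩
    (∑[ v ∈ V n ] ∑[ r ∈ xs ] (Both v r + Both v (s r)))
      ≡⟨ ∑-cong (V n) (λ v → trans (∑-+ xs _ _) (cong (∑ xs (Both v) +_) (s-sum (Both v)))) ⟩
    (∑[ v ∈ V n ] (∑ xs (Both v) + ∑ xs (Both v)))
      ≡⟨ ∑-+ (V n) _ _ ⟩
    (∑[ v ∈ V n ] ∑ xs (Both v)) + (∑[ v ∈ V n ] ∑ xs (Both v))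
      ≡⟨ cong₂ _+_ ∑-Both ∑-Both ⟩
    violations i γ + violations i γ + (violations i γ + violations i γ)
      ≡⟨ four (violations i γ) ⟩
    4 * violations i γ
      ∎
    where
    open ≤-Reasoning
    φ : Vec A n → Vec A n → ℕ
    φ v w = violation (x (lookup v i)) (x (lookup w i)) (γ v) (γ w)

    Both : Vec A n → A → ℕ
    Both v r = φ v (v [ i ]≔ r) + φ (v [ i ]≔ r) v

    pointwise : ∀ r v → differ (γ v) (sortAt i r γ v) ≤ Both v r + Both v (s r)
    pointwise r v rewrite lookup∘update i v r | lookup∘update i v (s r) | x-s r =
      sorted-differ (x (lookup v i)) (x r) (γ v) (γ (v [ i ]≔ r)) (γ (v [ i ]≔ s r))

    ∑-φ : (∑[ v ∈ V n ] ∑[ r ∈ xs ] φ v (v [ i ]≔ r)) ≡ violations i γ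
    ∑-φ = ∑-cong (V n) λ v → ∑-cong xs λ r →
      cong (λ a → violation (x (lookup v i)) (x a) (γ v) (γ (v [ i ]≔ r))) (lookup∘update i v r)

    ∑-Both : (∑[ v ∈ V n ] ∑ xs (Both v)) ≡ violations i γ + violations i γ
    ∑-Both = trans (∑-cong (V n) λ v → ∑-+ xs _ _) (trans (∑-+ (V n) _ _)
      (cong₂ _+_ ∑-φ (trans (sym (∑-exchange xs i φ)) ∑-φ)))

    four : ∀ m → m + m + (m + m) ≡ 4 * m
    four m = trans (+-assoc m m (m + m)) (cong (λ z → m + (m + (m + z))) (sym (+-identityʳ m)))

  distance-triangle : ∀ (γ δ ε : Vec A n → Bool) → distance γ ε ≤ distance γ δ + distance δ ε
  distance-triangle {n} γ δ ε = ≤-trans (∑-mono (V n) λ v → differ-triangle (γ v) (δ v) (ε v)) (≤-reflexive (∑-+ (V n) _ _))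

  -- The list `js` holds the voters still to be treated. One `r` must keep both the distance and the
  -- remaining violations small, so the two are added into `potential`; its average over `r` does
  -- not exceed four times the current violations, and some `r` attains at most the average. Legal
  -- voters stay legal, so one pass suffices.
  near-legal : ∀ (js : List (Fin n)) (γ : Vec A n → Bool) → (∀ j → j List.∈ js ⊎ Legal j γ) →
    ∃ λ γ' → (∀ j → Legal j γ') × L * distance γ γ' ≤ 4 * (∑[ j ∈ js ] violations j γ)
  near-legal {n} [] γ h = γ , legal , ≤-reflexive (trans (cong (L *_) (trans (∑-cong (V n) λ v → self (γ v)) (trans (∑-const (V n) 0) (*-zeroʳ (length (V n)))))) (*-zeroʳ L))
    where
    legal : ∀ j → Legal j γ
    legal j with h j
    ... | inj₂ l = l
    self : ∀ p → differ p p ≡ 0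
    self true  = refl
    self false = refl
  near-legal {n} (i ∷ js) γ h =
    let r , potential≤         = ∑-some-≤ xs {φ = potential} 0<L average
        γ' , legal , distance≤ = near-legal js (sortAt i r γ) (remaining r)
    in γ' , legal , (begin
      L * distance γ γ'
        ≤⟨ *-monoʳ-≤ L (distance-triangle γ (sortAt i r γ) γ') ⟩
      L * (distance γ (sortAt i r γ) + distance (sortAt i r γ) γ')
        ≡⟨ *-distribˡ-+ L (distance γ (sortAt i r γ)) _ ⟩
      L * distance γ (sortAt i r γ) + L * distance (sortAt i r γ) γ'
        ≤⟨ +-monoʳ-≤ (L * distance γ (sortAt i r γ)) distance≤ ⟩
      potential r
        ≤⟨ potential≤ ⟩
      4 * (∑[ j ∈ i ∷ js ] violations j γ)
        ∎)
    where
    open ≤-Reasoning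
    potential : A → ℕ
    potential r = L * distance γ (sortAt i r γ) + 4 * (∑[ j ∈ js ] violations j (sortAt i r γ))

    remaining : ∀ r j → j List.∈ js ⊎ Legal j (sortAt i r γ)
    remaining r j with h j
    ... | inj₁ (ListAny.here refl) = inj₂ (sortAt-legal i r γ)
    ... | inj₁ (ListAny.there j∈)  = inj₁ j∈
    ... | inj₂ legal               = inj₂ (sortAt-preserves-legal r γ legal)

    average : ∑ xs potential ≤ L * (4 * (∑[ j ∈ i ∷ js ] violations j γ))
    average = begin
      ∑ xs potential
        ≡⟨ ∑-+ xs _ _ ⟩
      (∑[ r ∈ xs ] L * distance γ (sortAt i r γ)) + (∑[ r ∈ xs ] 4 * (∑[ j ∈ js ] violations j (sortAt i r γ)))
        ≡⟨ cong₂ _+_ (∑-*ˡ xs L _) (trans (∑-*ˡ xs 4 _) (cong (4 *_) (∑-swap xs js _))) ⟩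
      L * (∑[ r ∈ xs ] distance γ (sortAt i r γ)) + 4 * (∑[ j ∈ js ] ∑[ r ∈ xs ] violations j (sortAt i r γ))
        ≤⟨ +-mono-≤ (*-monoʳ-≤ L (∑-sortAt-distance i γ)) (*-monoʳ-≤ 4 (∑-mono js λ j → ∑-sortAt-violations i j γ)) ⟩
      L * (4 * violations i γ) + 4 * (∑[ j ∈ js ] L * violations j γ)
        ≡⟨ cong (λ z → L * (4 * violations i γ) + 4 * z) (∑-*ˡ js L _) ⟩
      L * (4 * violations i γ) + 4 * (L * (∑[ j ∈ js ] violations j γ))
        ≡⟨ cong (L * (4 * violations i γ) +_) (x∙yz≈y∙xz *-commutativeSemigroup 4 L _) ⟩
      L * (4 * violations i γ) + L * (4 * (∑[ j ∈ js ] violations j γ))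
        ≡⟨ *-distribˡ-+ L (4 * violations i γ) _ ⟨
      L * (4 * violations i γ + 4 * (∑[ j ∈ js ] violations j γ))
        ≡⟨ cong (L *_) (*-distribˡ-+ 4 (violations i γ) _) ⟨
      L * (4 * (∑[ j ∈ i ∷ js ] violations j γ))
        ∎

-- Exchanging two alternatives

transpose-comm : ∀ (a b c : Fin k) → transpose a b c ≡ transpose b a c
transpose-comm a b c with c Fin.≟ a | c Fin.≟ b
... | yes refl | yes refl = refl
... | yes c≡a  | no _     rewrite dec-true (c Fin.≟ a) c≡a = refl
... | no _     | yes c≡b  rewrite dec-true (c Fin.≟ b) c≡b = refl
... | no c≢a   | no c≢b   rewrite dec-false (c Fin.≟ a) c≢a | dec-false (c Fin.≟ b) c≢b = refl

transpose-left : ∀ (a b : Fin k) → transpose a b a ≡ b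
transpose-left a b rewrite dec-true (a Fin.≟ a) refl = refl

transpose-right : ∀ (a b : Fin k) → transpose a b b ≡ a
transpose-right a b = trans (transpose-comm a b b) (transpose-left b a)

-- A constant function is top_H for a singleton H.
constant-NONMANIP : ∀ {f : SCF n k} (i : Fin n) c → (∀ σ → f σ ≡ c) → NONMANIP f
constant-NONMANIP i c const = inj₁ (i , ⁅ c ⁆ , c∈ , λ σ →
  trans (cong just (trans (const σ) (sym (x∈⁅y⁆⇒x≡y c (dictator-∈ i c∈ σ))))) (dictator-top i c∈ σ))
  where
  c∈ : Nonempty ⁅ c ⁆
  c∈ = c , x∈⁅x⁆ c

module TwoValues {n k} (a b : Fin k) (a≢b : a ≢ b) (g : SCF n k) (g∈ : ∀ σ → g σ ≡ a ⊎ g σ ≡ b) where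

  exchange : Ranking k → Ranking k
  exchange = relabel (transpose a b) (transpose b a) (λ _ → transpose-inverse a b)

  exchange-involutive : ∀ r → exchange (exchange r) ≡ r
  exchange-involutive r = ranking-ext (begin
    Vec.map (transpose a b) (Vec.map (transpose a b) (proj₁ r))  ≡⟨ map-∘ _ _ (proj₁ r) ⟨
    Vec.map (transpose a b ∘ transpose a b) (proj₁ r)            ≡⟨ map-cong (λ c → trans (cong (transpose a b) (transpose-comm a b c)) (transpose-inverse a b)) (proj₁ r) ⟩
    Vec.map (λ c → c) (proj₁ r)                                  ≡⟨ map-id (proj₁ r) ⟩
    proj₁ r                                                      ∎)
    where open ≡-Reasoning

  prefers-b? : (r : Ranking k) → Dec (b >[ r ] a)
  prefers-b? r = above? (proj₁ r) b a

  exchange-> : ∀ r → b >[ r ] a → a >[ exchange r ] b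
  exchange-> r h = Before⇒lookup (subst₂ (Before (proj₁ (exchange r))) (transpose-right a b) (transpose-left a b)
    (Before-map (transpose a b) (Above⇒Before h)))

  exchange-< : ∀ r → a >[ r ] b → b >[ exchange r ] a
  exchange-< r h = Before⇒lookup (subst₂ (Before (proj₁ (exchange r))) (transpose-left a b) (transpose-right a b)
    (Before-map (transpose a b) (Above⇒Before h)))

  prefers-b : Ranking k → Bool
  prefers-b r = does (prefers-b? r)

  not-prefers-b : ∀ r → ¬ b >[ r ] a → a >[ r ] b
  not-prefers-b r ¬b>a with >-total r a≢b
  ... | inj₁ a>b = a>b
  ... | inj₂ b>a = contradiction b>a ¬b>a

  prefers-b-true : ∀ r → prefers-b r ≡ true → b >[ r ] a
  prefers-b-true r eq with yes b>a ← prefers-b? r = b>a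

  prefers-b-false : ∀ r → prefers-b r ≡ false → a >[ r ] b
  prefers-b-false r eq with no ¬b>a ← prefers-b? r = not-prefers-b r ¬b>a

  prefers-b-exchange : ∀ r → prefers-b (exchange r) ≡ not (prefers-b r)
  prefers-b-exchange r = by-cases (prefers-b? r)
    where
    by-cases : (d : Dec (b >[ r ] a)) → prefers-b (exchange r) ≡ not (does d)
    by-cases (yes b>a) = dec-false (prefers-b? (exchange r)) (>-asym (exchange r) (exchange-> r b>a))
    by-cases (no ¬b>a) = dec-true (prefers-b? (exchange r)) (exchange-< r (not-prefers-b r ¬b>a))

  module _ (0<L : 0 < length (allRankings k)) where

    open Sorting (allRankings k) 0<L exchange (∑ᴿ-involution exchange exchange-involutive) prefers-b prefers-b-exchange

    private
      Ps : List (Profile n k)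
      Ps = allProfiles n k

      Rs : List (Ranking k)
      Rs = allRankings k

    is-b : Profile n k → Bool
    is-b σ = does (g σ Fin.≟ b)

    is-b-true : ∀ σ → is-b σ ≡ true → g σ ≡ b
    is-b-true σ eq with yes g≡b ← g σ Fin.≟ b = g≡b

    is-b-false : ∀ σ → is-b σ ≡ false → g σ ≡ a
    is-b-false σ eq with no g≢b ← g σ Fin.≟ b | g∈ σ
    ... | inj₁ g≡a = g≡a
    ... | inj₂ g≡b = contradiction g≡b g≢b

    -- The indicator of `gain` as a function of two profiles, the form to which `∑-exchange`
    -- applies.
    loss : Fin n → Profile n k → Profile n k → ℕ
    loss i σ σ' = 𝟙 (above? (proj₁ (lookup σ i)) (g σ') (g σ))

    -- When the outcome falls from b to a illegally, either the voter prefers a at `σ` and gains by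
    -- the move, or prefers b at `τ` and gains by moving back.
    violationAt≤ : ∀ i σ τ → violationAt i is-b σ τ ≤ loss i σ (σ [ i ]≔ τ) + loss i (σ [ i ]≔ τ) σ
    violationAt≤ i σ τ rewrite lookup∘update i σ τ = bound _ _ _ _ refl refl refl refl
      where
      σ' = σ [ i ]≔ τ
      bound : ∀ x y p q → prefers-b (lookup σ i) ≡ x → prefers-b τ ≡ y → is-b σ ≡ p → is-b σ' ≡ q →
        violation x y p q ≤ loss i σ σ' + 𝟙 (above? (proj₁ τ) (g σ) (g σ'))
      bound true  false p q _ _ _ _ = z≤n
      bound false y true false x≡ y≡ p≡ q≡ rewrite is-b-true σ p≡ | is-b-false σ' q≡ =
        𝟙-⊎ (above? (proj₁ (lookup σ i)) a b) (above? (proj₁ τ) b a) (inj₁ (prefers-b-false (lookup σ i) x≡))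
      bound true true true false x≡ y≡ p≡ q≡ rewrite is-b-true σ p≡ | is-b-false σ' q≡ =
        𝟙-⊎ (above? (proj₁ (lookup σ i)) a b) (above? (proj₁ τ) b a) (inj₂ (prefers-b-true τ y≡))
      bound false y     true  true  _ _ _ _ = z≤n
      bound false y     false q     _ _ _ _ = z≤n
      bound true  true  true  true  _ _ _ _ = z≤n
      bound true  true  false q     _ _ _ _ = z≤n

    violations≤ : ∀ i → violations i is-b ≤ gains g i + gains g i
    violations≤ i = begin
      violations i is-b
        ≤⟨ ∑-mono Ps (λ σ → ∑-mono Rs (violationAt≤ i σ)) ⟩
      (∑[ σ ∈ Ps ] ∑[ τ ∈ Rs ] (loss i σ (σ [ i ]≔ τ) + loss i (σ [ i ]≔ τ) σ))
        ≡⟨ ∑-cong Ps (λ σ → ∑-+ Rs (λ τ → loss i σ (σ [ i ]≔ τ)) (λ τ → loss i (σ [ i ]≔ τ) σ)) ⟩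
      (∑[ σ ∈ Ps ] ((∑[ τ ∈ Rs ] loss i σ (σ [ i ]≔ τ)) + (∑[ τ ∈ Rs ] loss i (σ [ i ]≔ τ) σ)))
        ≡⟨ ∑-+ Ps (λ σ → ∑[ τ ∈ Rs ] loss i σ (σ [ i ]≔ τ)) (λ σ → ∑[ τ ∈ Rs ] loss i (σ [ i ]≔ τ) σ) ⟩
      gains g i + (∑[ σ ∈ Ps ] ∑[ τ ∈ Rs ] loss i (σ [ i ]≔ τ) σ)
        ≡⟨ cong (gains g i +_) (∑-exchange Rs i (loss i)) ⟨
      gains g i + gains g i
        ∎
      where open ≤-Reasoning

    choose : (Profile n k → Bool) → SCF n k
    choose γ σ = if γ σ then b else a

    choose-monotone : ∀ γ → (∀ i → Legal i γ) → Monotone (choose γ)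
    choose-monotone γ legal σ i τ = ordered (γ σ) (γ σ') refl refl
      where
      σ' = σ [ i ]≔ τ

      no-violation : ∀ x y → violation x y true false ≡ 0 → x ≡ true × y ≡ false
      no-violation true false _ = refl , refl

      -- A rise from a to b at `σ` is a fall seen from `σ'`, so legality is applied at `σ'` with the
      -- old ranking as the replacement.
      back : violation (prefers-b τ) (prefers-b (lookup σ i)) (γ σ') (γ σ) ≡ 0
      back = subst₂ (λ r ρ → violation (prefers-b r) (prefers-b (lookup σ i)) (γ σ') (γ ρ) ≡ 0)
        (lookup∘update i σ τ) (trans ([]≔-idempotent σ i) ([]≔-lookup σ i)) (legal i σ' (lookup σ i))

      ordered : ∀ p q → γ σ ≡ p → γ σ' ≡ q →
        (if p then b else a) ≢ (if q then b else a) →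
        ((if p then b else a) >[ lookup σ i ] (if q then b else a)) × ((if q then b else a) >[ τ ] (if p then b else a))
      ordered true  true  _ _ neq = contradiction refl neq
      ordered false false _ _ neq = contradiction refl neq
      ordered true false p≡ q≡ _ with no-violation (prefers-b (lookup σ i)) (prefers-b τ)
        (subst₂ (λ p q → violation (prefers-b (lookup σ i)) (prefers-b τ) p q ≡ 0) p≡ q≡ (legal i σ τ))
      ... | x≡ , y≡ = prefers-b-true (lookup σ i) x≡ , prefers-b-false τ y≡
      ordered false true p≡ q≡ _ with no-violation (prefers-b τ) (prefers-b (lookup σ i))
        (subst₂ (λ p q → violation (prefers-b τ) (prefers-b (lookup σ i)) p q ≡ 0) q≡ p≡ back)
      ... | y≡ , x≡ = prefers-b-false (lookup σ i) x≡ , prefers-b-true τ y≡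

    -- Membership through monotonicity also demands that both values be attained; a function missing
    -- one of them is constant and enters as a dictatorship over a singleton.
    choose-NONMANIP : Fin n → ∀ γ → (∀ i → Legal i γ) → NONMANIP (choose γ)
    choose-NONMANIP i γ legal
      with ListAny.any? (λ σ → γ σ Data.Bool.≟ true) Ps | ListAny.any? (λ σ → γ σ Data.Bool.≟ false) Ps
    ... | no never | _ = constant-NONMANIP i a λ σ → is-a (γ σ) λ eq → never (List.lose (allVecsOf-complete allRankings-complete σ) eq)
      where
      is-a : ∀ p → p ≢ true → (if p then b else a) ≡ a
      is-a true  ≢t = contradiction refl ≢t
      is-a false _  = refl
    ... | yes _ | no never = constant-NONMANIP i b λ σ → is-b′ (γ σ) λ eq → never (List.lose (allVecsOf-complete allRankings-complete σ) eq)
      where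
      is-b′ : ∀ p → p ≢ false → (if p then b else a) ≡ b
      is-b′ true  _  = refl
      is-b′ false ≢f = contradiction refl ≢f
    ... | yes some-b | yes some-a = inj₂ (choose-monotone γ legal , a , b , a≢b , (λ σ → values (γ σ)) ,
      attained some-a , attained some-b)
      where
      values : ∀ p → (if p then b else a) ≡ a ⊎ (if p then b else a) ≡ b
      values true  = inj₂ refl
      values false = inj₁ refl
      attained : ∀ {p} → ListAny.Any (λ σ → γ σ ≡ p) Ps → ∃ λ σ → choose γ σ ≡ (if p then b else a)
      attained any with ListAny.satisfied any
      ... | σ , eq = σ , cong (λ p → if p then b else a) eq

    near-monotone : Fin n → ∀ {B} → (∀ i → gains g i ≤ length Rs * B) →
      ∃ λ g' → NONMANIP g' × disagreements g g' ≤ 4 * (n * (B + B))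
    near-monotone i {B} gains≤ =
      let γ , legal , distance≤ = near-legal (List.allFin n) is-b (λ j → inj₁ (List.∈-allFin j))
      in choose γ , choose-NONMANIP i γ legal , ≤-trans (∑-mono Ps (pointwise γ))
        (*-cancelˡ-≤ (length Rs) ⦃ ℕ.>-nonZero 0<L ⦄ (≤-trans distance≤ bound))
      where
      pointwise : ∀ γ σ → 𝟙 (¬? (g σ Fin.≟ choose γ σ)) ≤ differ (is-b σ) (γ σ)
      pointwise γ σ = 𝟙≤ (¬? (g σ Fin.≟ choose γ σ)) (differs (is-b σ) (γ σ) refl)
        where
        differs : ∀ p q → is-b σ ≡ p → g σ ≢ (if q then b else a) → 1 ≤ differ p q
        differs true  true  p≡ neq = contradiction (is-b-true σ p≡) neq
        differs true  false _  _   = s≤s z≤n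
        differs false true  _  _   = s≤s z≤n
        differs false false p≡ neq = contradiction (is-b-false σ p≡) neq

      open ≤-Reasoning
      bound : 4 * (∑[ j ∈ List.allFin n ] violations j is-b) ≤ length Rs * (4 * (n * (B + B)))
      bound = begin
        4 * (∑[ j ∈ List.allFin n ] violations j is-b)
          ≤⟨ *-monoʳ-≤ 4 (∑-bounded (List.allFin n) λ j → ≤-trans (violations≤ j) (+-mono-≤ (gains≤ j) (gains≤ j))) ⟩
        4 * (length (List.allFin n) * (length Rs * B + length Rs * B))
          ≡⟨ cong (λ m → 4 * (m * (length Rs * B + length Rs * B))) (length-tabulate {n = n} (λ j → j)) ⟩
        4 * (n * (length Rs * B + length Rs * B))
          ≡⟨ cong (λ z → 4 * (n * z)) (*-distribˡ-+ (length Rs) B B) ⟨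
        4 * (n * (length Rs * (B + B)))
          ≡⟨ cong (4 *_) (x∙yz≈y∙xz *-commutativeSemigroup n (length Rs) (B + B)) ⟩
        4 * (length Rs * (n * (B + B)))
          ≡⟨ x∙yz≈y∙xz *-commutativeSemigroup 4 (length Rs) (n * (B + B)) ⟩
        length Rs * (4 * (n * (B + B)))
          ∎

-- Bounds on probabilities

-- The root `s` is raised only when s² falls short of m + 1; then s² ≤ m, and (s+1)² ≤ 2(1 + s²) ≤
-- 4(m+1).
square-root : ∀ m → ∃ λ s → m ≤ s * s × s * s ≤ 4 * m
square-root zero    = 0 , z≤n , z≤n
square-root (suc m) with square-root m
... | s , m≤s² , s²≤4m with suc m ≤? s * s
...   | yes m<s² = s , m<s² , ≤-trans s²≤4m (*-monoʳ-≤ 4 (n≤1+n m))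
...   | no  m≮s² = suc s , ≤-trans (s≤s m≤s²) (s≤s (≤-trans (*-monoʳ-≤ s (n≤1+n s)) (m≤n+m _ s))) , (begin
  suc s * suc s            ≡⟨ expand s ⟩
  1 + s * s + 2 * s        ≤⟨ +-monoʳ-≤ (1 + s * s) (2s≤1+s² s) ⟩
  1 + s * s + (1 + s * s)  ≤⟨ +-mono-≤ {1 + s * s} (s≤s s²≤m) (s≤s s²≤m) ⟩
  suc m + suc m            ≤⟨ +-monoʳ-≤ (suc m) (m≤m+n (suc m) _) ⟩
  4 * suc m                ∎)
  where
  open ≤-Reasoning
  s²≤m : s * s ≤ m
  s²≤m = ≤-pred (≰⇒> m≮s²)
  expand : ∀ s → suc s * suc s ≡ 1 + s * s + 2 * s
  expand = solve-∀
  2s≤1+s² : ∀ s → 2 * s ≤ 1 + s * s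
  2s≤1+s² zero          = z≤n
  2s≤1+s² (suc zero)    = ≤-refl
  2s≤1+s² (suc (suc s)) = m≤n⇒m≤1+n (*-monoˡ-≤ (2 + s) {2} {2 + s} (s≤s (s≤s z≤n)))

∈⇒0<length : ∀ {xs : List A} {x} → x List.∈ xs → 0 < length xs
∈⇒0<length (ListAny.here _)  = s≤s z≤n
∈⇒0<length (ListAny.there _) = s≤s z≤n

0<allRankings : ∀ k → 0 < length (allRankings k)
0<allRankings k = ∈⇒0<length (allRankings-complete (ranking (Vec.allFin k) ∈-allFin⁺))

0<allProfiles : ∀ n k → 0 < length (allProfiles n k)
0<allProfiles n k = ∈⇒0<length (allVecsOf-complete (allRankings-complete {k})
  (Vec.replicate n (ranking (Vec.allFin k) ∈-allFin⁺)))

disagreements≤ : ∀ (f g : SCF n k) → disagreements f g ≤ length (allProfiles n k)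
disagreements≤ {n} {k} f g = ≤-trans (∑-bounded (allProfiles n k) λ σ → 𝟙≤1 (¬? (f σ Fin.≟ g σ))) (≤-reflexive (*-identityʳ _))

disagreements-triangle : ∀ (f g h : SCF n k) → disagreements f h ≤ disagreements f g + disagreements g h
disagreements-triangle {n} {k} f g h = ≤-trans (∑-mono (allProfiles n k) pointwise)
  (≤-reflexive (∑-+ (allProfiles n k) (λ σ → 𝟙 (¬? (f σ Fin.≟ g σ))) (λ σ → 𝟙 (¬? (g σ Fin.≟ h σ)))))
  where
  pointwise : ∀ σ → 𝟙 (¬? (f σ Fin.≟ h σ)) ≤ 𝟙 (¬? (f σ Fin.≟ g σ)) + 𝟙 (¬? (g σ Fin.≟ h σ))
  pointwise σ = 𝟙≤ (¬? (f σ Fin.≟ h σ)) (λ f≢h → 𝟙-⊎ (¬? (f σ Fin.≟ g σ)) (¬? (g σ Fin.≟ h σ)) (one-differs f≢h))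
    where
    one-differs : f σ ≢ h σ → f σ ≢ g σ ⊎ g σ ≢ h σ
    one-differs f≢h with f σ Fin.≟ g σ
    ... | yes f≡g = inj₂ λ g≡h → f≢h (trans f≡g g≡h)
    ... | no  f≢g = inj₁ f≢g

square-cancel-≤ : ∀ {m n} → m * m ≤ n * n → m ≤ n
square-cancel-≤ {m} {n} le with m ≤? n
... | yes m≤n = m≤n
... | no  m≰n = contradiction le (<⇒≱ (*-mono-< (≰⇒> m≰n) (≰⇒> m≰n)))

factor : ℕ → ℕ → ℕ
factor n k = 100 * n ^ 4 * k ^ 8

module _ {n k : ℕ} (1≤n : 1 ≤ n) (1≤k : 1 ≤ k) where

  private instance
    n≢0 : ℕ.NonZero n
    n≢0 = ℕ.>-nonZero 1≤n
    k≢0 : ℕ.NonZero k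
    k≢0 = ℕ.>-nonZero 1≤k

  100*≤factor : ∀ {m} → m ≤ n ^ 4 * k ^ 8 → 100 * m ≤ factor n k
  100*≤factor m≤ = ≤-trans (*-monoʳ-≤ 100 m≤) (≤-reflexive (sym (*-assoc 100 (n ^ 4) (k ^ 8))))

  100k⁶≤factor : 100 * k ^ 6 ≤ factor n k
  100k⁶≤factor = 100*≤factor (≤-trans (^-monoʳ-≤ k {6} {8} (m≤m+n 6 2)) (m≤n*m (k ^ 8) (n ^ 4) ⦃ m^n≢0 n 4 ⦄))

  100nk²≤factor : 100 * (n * k ^ 2) ≤ factor n k
  100nk²≤factor = 100*≤factor (*-mono-≤
    (≤-trans (≤-reflexive (sym (^-identityʳ n))) (^-monoʳ-≤ n {1} {4} (m≤m+n 1 3)))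
    (^-monoʳ-≤ k {2} {8} (m≤m+n 2 6)))

  100≤factor : 100 ≤ factor n k
  100≤factor = 100*≤factor {1} (*-mono-≤ (^-monoʳ-≤ n {0} {4} z≤n) (^-monoʳ-≤ k {0} {8} z≤n))

  module _ (f g : SCF n k) {A : ℕ}
           (e≤A : disagreements f g ≤ A) (m≤A : local-manipulations f ≤ A) where

    private
      N : ℕ
      N = length (allProfiles n k)

      L : ℕ
      L = length (allRankings k)

    -- As no distance exceeds 1, the linear bound here and the quadratic one below both weaken to
    -- the same cubic form.
    cubic-of-linear : ∀ {d} → d ≤ N → d ≤ factor n k * A → d * d * d ≤ factor n k * (A * (N * N))
    cubic-of-linear {d} d≤N d≤ = begin
      d * d * d                     ≡⟨ *-assoc d d d ⟩
      d * (d * d)                   ≤⟨ *-mono-≤ d≤ (*-mono-≤ d≤N d≤N) ⟩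
      factor n k * A * (N * N)      ≡⟨ *-assoc (factor n k) A (N * N) ⟩
      factor n k * (A * (N * N))    ∎
      where open ≤-Reasoning

    cubic-of-quadratic : ∀ {d} → d ≤ N → d * d ≤ factor n k * (N * A) → d * d * d ≤ factor n k * (A * (N * N))
    cubic-of-quadratic {d} d≤N d²≤ = begin
      d * d * d                     ≤⟨ *-mono-≤ d²≤ d≤N ⟩
      factor n k * (N * A) * N      ≡⟨ rearrange (factor n k) N A ⟩
      factor n k * (A * (N * N))    ∎
      where
      open ≤-Reasoning
      rearrange : ∀ F N A → F * (N * A) * N ≡ F * (A * (N * N))
      rearrange = solve-∀

    -- Two of the four k² come from the local manipulations of `f`; the other two come from the
    -- transfer, whose term 2A is enlarged by the factor k².
    gains-g≤ : ∀ i → gains g i ≤ L * (4 * (k * k) * A)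
    gains-g≤ i = begin
      gains g i
        ≤⟨ gains-transfer f g i ⟩
      gains f i + L * (disagreements f g + disagreements f g)
        ≤⟨ +-mono-≤ (gains≤ f i (λ σ → 𝟙 (manipR? 3 f σ)) manipulable) (*-monoʳ-≤ L (+-mono-≤ e≤A e≤A)) ⟩
      L * (k * k * (local-manipulations f + local-manipulations f)) + L * (A + A)
        ≤⟨ +-mono-≤ (*-monoʳ-≤ L (*-monoʳ-≤ (k * k) (+-mono-≤ m≤A m≤A))) (*-monoʳ-≤ L (m≤n*m (A + A) (k * k) ⦃ m*n≢0 k k ⦄)) ⟩
      L * (k * k * (A + A)) + L * (k * k * (A + A))
        ≡⟨ collect L (k * k) A ⟩
      L * (4 * (k * k) * A)
        ∎
      where
      open ≤-Reasoning
      collect : ∀ L q A → L * (q * (A + A)) + L * (q * (A + A)) ≡ L * (4 * q * A)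
      collect = solve-∀
      manipulable : ∀ σ p → f (σ [ i ]≔ swapRanking p (lookup σ i)) >[ lookup σ i ] f σ → 1 ≤ 𝟙 (manipR? 3 f σ)
      manipulable σ p better = ≤-reflexive (sym (𝟙-yes (manipR? 3 f σ) (local-manipulation f i σ p better)))

    -- This is D(f,g')³ ≤ F A/N with denominators cleared and F = `factor n k`. The theorem allows
    -- F³ in place of F, and this slack later yields strictness.
    Conclusion : Set
    Conclusion = ∃ λ g' → NONMANIP g' ×
      disagreements f g' * disagreements f g' * disagreements f g' ≤ factor n k * (A * (N * N))

    one-coordinate : Fin k → ∀ i → (∀ σ σ' → lookup σ i ≡ lookup σ' i → g σ ≡ g σ') → Conclusion
    one-coordinate a₀ i dep with square-root (N * A)
    ... | s , NA≤s² , s²≤4NA =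
      let g' , nonmanip , close = near-dictator g i dep {A} {4 * (k * k)} {s}
            (*-mono-≤ {1} {4} (s≤s z≤n) (*-mono-≤ 1≤k 1≤k)) (0<allRankings k) (gains-g≤ i) NA≤s² a₀
      in g' , nonmanip , cubic-of-quadratic (disagreements≤ f g') (square-bound g' close)
      where
      open ≤-Reasoning
      e≤s : disagreements f g ≤ s
      e≤s = square-cancel-≤ (≤-trans (*-mono-≤ (disagreements≤ f g) e≤A) NA≤s²)

      linear-bound : ∀ g' → disagreements g g' ≤ k * (4 * (k * k) * s) → disagreements f g' ≤ 5 * k ^ 3 * s
      linear-bound g' close = begin
        disagreements f g'                      ≤⟨ disagreements-triangle f g g' ⟩
        disagreements f g + disagreements g g'  ≤⟨ +-mono-≤ (≤-trans e≤s (m≤n*m s (k ^ 3) ⦃ m^n≢0 k 3 ⦄)) close ⟩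
        k ^ 3 * s + k * (4 * (k * k) * s)       ≡⟨ collect k s ⟩
        5 * k ^ 3 * s                           ∎
        where
        collect : ∀ k s → (k * (k * (k * 1))) * s + k * (4 * (k * k) * s) ≡ 5 * (k * (k * (k * 1))) * s
        collect = solve-∀

      square-bound : ∀ g' → disagreements g g' ≤ k * (4 * (k * k) * s) →
        disagreements f g' * disagreements f g' ≤ factor n k * (N * A)
      square-bound g' close = begin
        disagreements f g' * disagreements f g'  ≤⟨ *-mono-≤ (linear-bound g' close) (linear-bound g' close) ⟩
        -- The constant 100 is 5² · 4: the 5 is 1 + 4 from the triangle inequality, the 4 is the
        -- rounding loss in `square-root`.
        5 * k ^ 3 * s * (5 * k ^ 3 * s)          ≡⟨ regroup k s ⟩
        25 * k ^ 6 * (s * s)                     ≤⟨ *-monoʳ-≤ (25 * k ^ 6) s²≤4NA ⟩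
        25 * k ^ 6 * (4 * (N * A))               ≡⟨ regroup′ (k ^ 6) (N * A) ⟩
        100 * k ^ 6 * (N * A)                    ≤⟨ *-monoˡ-≤ (N * A) 100k⁶≤factor ⟩
        factor n k * (N * A)                     ∎
        where
        regroup : ∀ k s → 5 * (k * (k * (k * 1))) * s * (5 * (k * (k * (k * 1))) * s) ≡ 25 * (k * (k * (k * (k * (k * (k * 1)))))) * (s * s)
        regroup = solve-∀
        regroup′ : ∀ q m → 25 * q * (4 * m) ≡ 100 * q * m
        regroup′ = solve-∀

    two-values : Fin n → ∀ a b → (∀ σ → g σ ≡ a ⊎ g σ ≡ b) → Conclusion
    two-values i₀ a b g∈ with a Fin.≟ b
    ... | yes refl = g , constant-NONMANIP i₀ a (λ σ → Data.Sum.reduce (g∈ σ)) ,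
      cubic-of-linear (disagreements≤ f g) (≤-trans e≤A (m≤n*m A (factor n k) ⦃ ℕ.>-nonZero (≤-trans (s≤s z≤n) 100≤factor) ⦄))
    ... | no a≢b =
      let g' , nonmanip , close = TwoValues.near-monotone a b a≢b g g∈ (0<allRankings k) i₀ gains-g≤
      in g' , nonmanip , cubic-of-linear (disagreements≤ f g') (linear-bound g' close)
      where
      open ≤-Reasoning
      G : ℕ
      G = 4 * (k * k) * A
      linear-bound : ∀ g' → disagreements g g' ≤ 4 * (n * (G + G)) → disagreements f g' ≤ factor n k * A
      linear-bound g' close = begin
        disagreements f g'                         ≤⟨ disagreements-triangle f g g' ⟩
        disagreements f g + disagreements g g'     ≤⟨ +-mono-≤ e≤A close ⟩
        -- The second summand equals 32 n k² A; inflating the first to 68 n k² A makes the total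
        -- exactly 100 n k² A.
        A + 4 * (n * (G + G))                      ≤⟨ +-monoˡ-≤ (4 * (n * (G + G))) (m≤n*m A (68 * (n * k ^ 2)) ⦃ m*n≢0 68 (n * k ^ 2) ⦃ _ ⦄ ⦃ m*n≢0 n (k ^ 2) ⦃ n≢0 ⦄ ⦃ m^n≢0 k 2 ⦄ ⦄ ⦄) ⟩
        68 * (n * k ^ 2) * A + 4 * (n * (G + G))   ≡⟨ collect n k A ⟩
        100 * (n * k ^ 2) * A                      ≤⟨ *-monoˡ-≤ A 100nk²≤factor ⟩
        factor n k * A                             ∎
        where
        collect : ∀ n k A → 68 * (n * (k * (k * 1))) * A + 4 * (n * (4 * (k * k) * A + 4 * (k * k) * A)) ≡ 100 * (n * (k * (k * 1))) * A
        collect = solve-∀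

    near-NONMANIP : Fin n → Fin k → NONMANIP̄ g → Conclusion
    near-NONMANIP i₀ a₀ (inj₁ (i , dep))     = one-coordinate a₀ i dep
    near-NONMANIP i₀ a₀ (inj₂ (a , b , g∈)) = two-values i₀ a b g∈

-- Passage to rational numbers

toℚᵘ-frac : ∀ a N → toℚᵘ (frac a (suc N)) ℚᵘ.≃ mkℚᵘ (ℤ.+ a) N
toℚᵘ-frac a N = ℚ.toℚᵘ-fromℚᵘ (mkℚᵘ (ℤ.+ a) N)

frac-mono : ∀ {a b} N → a ≤ b → frac a N ℚ.≤ frac b N
frac-mono zero    a≤b = ℚ.≤-refl
frac-mono {a} {b} (suc N) a≤b = ℚ.toℚᵘ-cancel-≤ (begin
  toℚᵘ (frac a (suc N))  ≃⟨ toℚᵘ-frac a N ⟩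
  mkℚᵘ (ℤ.+ a) N           ≤⟨ *≤* (ℤ.*-monoʳ-≤-nonNeg (ℤ.+ suc N) (ℤ.+≤+ a≤b)) ⟩
  mkℚᵘ (ℤ.+ b) N           ≃⟨ toℚᵘ-frac b N ⟨
  toℚᵘ (frac b (suc N))  ∎)
  where open ℚᵘ.≤-Reasoning

0≤frac : ∀ a N → 0ℚ ℚ.≤ frac a N
0≤frac a zero    = ℚ.≤-refl
0≤frac a (suc N) = ℚ.nonNegative⁻¹ (frac a (suc N)) ⦃ ℚ.normalize-nonNeg a (suc N) ⦄

frac-strict : ∀ {F G} → F < G → (ℤ.+ F) ℚ./ 1 ℚ.< (ℤ.+ G) ℚ./ 1
frac-strict {F} {G} F<G = ℚ.toℚᵘ-cancel-< (begin-strict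
  toℚᵘ (frac F 1)  ≃⟨ toℚᵘ-frac F 0 ⟩
  mkℚᵘ (ℤ.+ F) 0     <⟨ *<* (ℤ.*-monoʳ-<-pos (ℤ.+ 1) (ℤ.+<+ F<G)) ⟩
  mkℚᵘ (ℤ.+ G) 0     ≃⟨ toℚᵘ-frac G 0 ⟨
  toℚᵘ (frac G 1)  ∎)
  where open ℚᵘ.≤-Reasoning

frac-cubic : ∀ {d F A} N → d * d * d ≤ F * (A * (suc N * suc N)) →
  frac d (suc N) ℚ.* frac d (suc N) ℚ.* frac d (suc N) ℚ.≤ (ℤ.+ F) ℚ./ 1 ℚ.* frac A (suc N)
frac-cubic {d} {F} {A} N le = ℚ.toℚᵘ-cancel-≤ (begin
  toℚᵘ (x ℚ.* x ℚ.* x)                             ≃⟨ ℚᵘ.≃-trans (ℚ.toℚᵘ-homo-* (x ℚ.* x) x) (ℚᵘ.*-congʳ {toℚᵘ x} (ℚ.toℚᵘ-homo-* x x)) ⟩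
  toℚᵘ x ℚᵘ.* toℚᵘ x ℚᵘ.* toℚᵘ x                   ≃⟨ ℚᵘ.*-cong (ℚᵘ.*-cong x≃ x≃) x≃ ⟩
  mkℚᵘ (ℤ.+ d) N ℚᵘ.* mkℚᵘ (ℤ.+ d) N ℚᵘ.* mkℚᵘ (ℤ.+ d) N ≤⟨ *≤* cross ⟩
  mkℚᵘ (ℤ.+ F) 0 ℚᵘ.* mkℚᵘ (ℤ.+ A) N                   ≃⟨ ℚᵘ.*-cong (toℚᵘ-frac F 0) (toℚᵘ-frac A N) ⟨
  toℚᵘ (frac F 1) ℚᵘ.* toℚᵘ (frac A (suc N))       ≃⟨ ℚ.toℚᵘ-homo-* (frac F 1) (frac A (suc N)) ⟨
  toℚᵘ ((ℤ.+ F) ℚ./ 1 ℚ.* frac A (suc N))            ∎)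
  where
  open ℚᵘ.≤-Reasoning
  x : ℚ
  x = frac d (suc N)
  x≃ : toℚᵘ x ℚᵘ.≃ mkℚᵘ (ℤ.+ d) N
  x≃ = toℚᵘ-frac d N
  M : ℕ
  M = suc N
  crossℕ : d * d * d * (1 * M) ≤ F * A * (M * M * M)
  crossℕ = ≤-trans (*-monoˡ-≤ (1 * M) le) (≤-reflexive (rearrange F A M))
    where
    rearrange : ∀ F A M → F * (A * (M * M)) * (1 * M) ≡ F * A * (M * M * M)
    rearrange = solve-∀
  cross : (ℤ.+ d ℤ.* ℤ.+ d ℤ.* ℤ.+ d) ℤ.* ℤ.+ (1 * M) ℤ.≤ (ℤ.+ F ℤ.* ℤ.+ A) ℤ.* ℤ.+ (M * M * M)
  cross = subst₂ ℤ._≤_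
    (trans (ℤ.pos-* (d * d * d) (1 * M)) (cong (ℤ._* ℤ.+ (1 * M)) (trans (ℤ.pos-* (d * d) d) (cong (ℤ._* ℤ.+ d) (ℤ.pos-* d d)))))
    (trans (ℤ.pos-* (F * A) (M * M * M)) (cong (ℤ._* ℤ.+ (M * M * M)) (ℤ.pos-* F A)))
    (ℤ.+≤+ crossℕ)

-- Strictness comes from F < F³ for F ≥ 2 together with α > 0. The right-hand side is the cube of F
-- α^{1/3}, which keeps the statement rational.
cubic-bound : ∀ {d F A α} N → 0 < N → 2 ≤ F → d * d * d ≤ F * (A * (N * N)) → frac A N ℚ.≤ α → 0ℚ ℚ.< α →
  frac d N ℚ.* frac d N ℚ.* frac d N ℚ.< (ℤ.+ (F ^ 3)) ℚ./ 1 ℚ.* α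
cubic-bound {d} {F} {A} {α} (suc N) _ 2≤F le A≤α 0<α = begin-strict
  x ℚ.* x ℚ.* x                     ≤⟨ frac-cubic {d} {F} {A} N le ⟩
  (ℤ.+ F) ℚ./ 1 ℚ.* frac A (suc N)    ≤⟨ ℚ.*-monoˡ-≤-nonNeg ((ℤ.+ F) ℚ./ 1) ⦃ ℚ.normalize-nonNeg F 1 ⦄ A≤α ⟩
  (ℤ.+ F) ℚ./ 1 ℚ.* α                 <⟨ ℚ.*-monoˡ-<-pos α ⦃ ℚ.positive 0<α ⦄ (frac-strict F<F³) ⟩
  (ℤ.+ (F ^ 3)) ℚ./ 1 ℚ.* α           ∎
  where
  open ℚ.≤-Reasoning
  x : ℚ
  x = frac d (suc N)
  F<F³ : F < F ^ 3
  F<F³ = subst (_< F ^ 3) (^-identityʳ F) (^-monoʳ-< F 2≤F {1} {3} (s≤s (s≤s z≤n)))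

Prob≡ : ∀ {P : Profile n k → Set} (P? : ∀ σ → Dec (P σ)) →
  Prob P? ≡ frac (∑ (allProfiles n k) (λ σ → 𝟙 (P? σ))) (length (allProfiles n k))
Prob≡ {n} {k} P? = cong (λ c → frac c (length (allProfiles n k))) (length-filter≡∑ P? (allProfiles n k))

Prob-mono : ∀ {P Q : Profile n k → Set} (P? : ∀ σ → Dec (P σ)) (Q? : ∀ σ → Dec (Q σ)) →
  (∀ σ → P σ → Q σ) → Prob P? ℚ.≤ Prob Q?
Prob-mono {n} {k} P? Q? imp = subst₂ ℚ._≤_ (sym (Prob≡ P?)) (sym (Prob≡ Q?))
  (frac-mono (length (allProfiles n k)) (∑-mono (allProfiles n k) λ σ → 𝟙-mono (P? σ) (Q? σ) (imp σ)))

ManipR⇒Manip : ∀ r (f : SCF n k) σ → ManipR r f σ → Manip f σ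
ManipR⇒Manip r f σ (i , any) = i , ListAny.map proj₂ any

theorem1p5 : (n k : ℕ) → n ℕ.≥ 1 → k ℕ.≥ 3 → (α : ℚ) → 0ℚ ℚ.≤ α →
    (f : SCF n k) →
    (∃ λ (g : SCF n k) → NONMANIP̄ g × D f g ℚ.≤ α) →
    (∃ λ (g : SCF n k) → NONMANIP g ×
    D f g ℚ.* D f g ℚ.* D f g
    ℚ.< ((ℤ.+ ((100 ℕ.* n ℕ.^ 4 ℕ.* k ℕ.^ 8) ℕ.^ 3)) ℚ./ 1) ℚ.* α)
    ⊎ (Prob (manipR? 3 f) ℚ.≤ Prob (manip? f) × α ℚ.≤ Prob (manipR? 3 f))
-- The alternative is settled by deciding α ≤ P(M₃). If this fails, both the probability of M₃ and
-- D(f,g) are at most α, so the larger of the two counts serves as `A`.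
theorem1p5 n k n≥1 k≥3 α 0≤α f (g , g∈ , D≤α) = Data.Sum.swap (Data.Sum.map
  (Prob-mono (manipR? 3 f) (manip? f) (ManipR⇒Manip 3 f) ,_)
  (λ α≰M → g' , nonmanip , D³< (ℚ.≰⇒> α≰M))
  (toSum (α ℚ.≤? Prob (manipR? 3 f))))
  where
  1≤k : 1 ≤ k
  1≤k = ≤-trans (s≤s z≤n) k≥3

  N e m : ℕ
  N = length (allProfiles n k)
  e = disagreements f g
  m = local-manipulations f

  D≡ : ∀ h → D f h ≡ frac (disagreements f h) N
  D≡ h = Prob≡ (λ σ → ¬? (f σ Fin.≟ h σ))

  near : Conclusion n≥1 1≤k f g (m≤m⊔n e m) (m≤n⊔m e m)
  near = near-NONMANIP n≥1 1≤k f g (m≤m⊔n e m) (m≤n⊔m e m) (Fin.fromℕ< n≥1) (Fin.fromℕ< 1≤k) g∈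

  g' : SCF n k
  g' = proj₁ near

  nonmanip : NONMANIP g'
  nonmanip = proj₁ (proj₂ near)

  D³< : Prob (manipR? 3 f) ℚ.< α → D f g' ℚ.* D f g' ℚ.* D f g' ℚ.< ((ℤ.+ (factor n k ^ 3)) ℚ./ 1) ℚ.* α
  D³< M<α = subst (λ x → x ℚ.* x ℚ.* x ℚ.< ((ℤ.+ (factor n k ^ 3)) ℚ./ 1) ℚ.* α) (sym (D≡ g'))
    (cubic-bound N (0<allProfiles n k) (≤-trans (s≤s (s≤s z≤n)) (100≤factor n≥1 1≤k)) (proj₂ (proj₂ near)) A≤α 0<α)
    where
    m<α : frac m N ℚ.< α
    m<α = subst (ℚ._< α) (Prob≡ (manipR? 3 f)) M<α

    -- For α = 0 the second alternative always holds, so α is positive whenever the first one has to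
    -- be shown.
    0<α : 0ℚ ℚ.< α
    0<α = ℚ.≤-<-trans (0≤frac m N) m<α

    A≤α : frac (e ⊔ m) N ℚ.≤ α
    A≤α = Data.Sum.[ (λ eq → subst (λ a → frac a N ℚ.≤ α) (sym eq) (subst (ℚ._≤ α) (D≡ g) D≤α))
                   , (λ eq → subst (λ a → frac a N ℚ.≤ α) (sym eq) (ℚ.<⇒≤ m<α)) ]′ (⊔-sel e m)
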